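{- Let $G=(V,E)$ be a finite graph with at least one vertex and $k>0$ an integer. The following are equivalent: (i) $G$ has a blockage of order $k-1$; (ii) $G$ has an $\mathcal F_k^{(2)}$-tangle of $S_k$; (iii) $G$ has no $S_k$-tree over $\mathcal F_k^{(2)}$; (iv) $G$ has path-width at least $k-1$.
   Context: An (oriented vertex) separation of $G$ is a pair $(A,B)$ of (possibly empty) subsets of $V$ with $A\cup B=V$ and no edge between $A\setminus B$ and $B\setminus A$; $\vec U$ is the set of these, ordered by $(A,B)\le(C,D)$ iff $A\subseteq C$ and $B\supseteq D$, inverse $(B,A)$; $\{A,B\}$ is the unoriented separation, of order $|A\cap B|$. $\vec S_k$: oriented separations of order $<k$; $S_k$: unoriented ones. An orientation of $S_k$ is a set $O\subseteq\vec S_k$ containing exactly one of $(A,B),(B,A)$ for each $\{A,B\}\in S_k$; it is consistent if there are no $(A,B),(C,D)\in\vec S_k$ with $\{A,B\}\ne\{C,D\}$, $(A,B)<(C,D)$, $(B,A)\in O$, $(C,D)\in O$. A star is a set $\sigma$ of separations with $(A,B)\ne(B,A)$ for each element and $(A,B)\le(D,C)$ for distinct $(A,B),(C,D)\in\sigma$. $\mathcal F_k$ is the set of stars $\{(A_i,B_i):i=0,\dots,n\}\subseteq\vec U$ with $|\bigcap_{i=0}^nB_i|<k$ (intersection $=V$ for the empty star), and $\mathcal F_k^{(2)}=\{\sigma\in\mathcal F_k:|\sigma|\le2\}$. An $\mathcal F_k^{(2)}$-tangle of $S_k$ is a consistent orientation of $S_k$ with no subset in $\mathcal F_k^{(2)}$.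 An $S_k$-tree over $\mathcal F_k^{(2)}$ is a pair $(T,\alpha)$, $T$ a finite tree with at least one node, $\alpha$ assigning to each ordered pair $(x,y)$ with $xy\in E(T)$ an element $\alpha(x,y)\in\vec S_k$ with $\alpha(y,x)$ the inverse of $\alpha(x,y)$ and $\{\alpha(x,t):xt\in E(T)\}\in\mathcal F_k^{(2)}$ for every node $t$. For $X\subseteq V$, $\partial(X)$ is the set of vertices in $X$ with a neighbour outside $X$. A blockage of order $k-1$ is a collection $\mathcal B$ of subsets of $V$ such that: (B1) $|\partial(X)|<k$ for all $X\in\mathcal B$; (B2) $X'\in\mathcal B$ whenever $X'\subseteq X\in\mathcal B$ and $|\partial(X')|<k$; (B3) for every $\{X_1,X_2\}\in S_k$ exactly one of $X_1,X_2$ lies in $\mathcal B$. Path-width is the least width of a tree-decomposition whose decomposition tree is a path. -}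

module Defs where

open import Level using (0ℓ)
open import Data.Nat using (ℕ; zero; suc; _<_; _≤_; _⊔_; _∸_)
open import Data.Bool using (Bool; true; false; _∧_; not)
open import Data.Fin using (Fin) renaming (zero to fzero; suc to fsuc; _≤_ to _≤ᶠ_)
open import Data.Fin.Subset using (Subset; _∈_; _∉_; _⊆_; _∩_; ⊤; ∣_∣)
open import Data.Vec using (tabulate; lookup)
open import Data.List using (List; []; _∷_; _++_; [_]; length; foldr; allFin)
open import Data.Bool.ListAction using (any)
open import Data.List.Relation.Unary.All using (All)
open import Data.List.Relation.Unary.Linked using (Linked)
open import Data.List.Relation.Unary.Unique.Propositional using (Unique)
open import Data.List.Membership.Propositional using () renaming (_∈_ to _∈ₗ_)
open import Data.Product using (Σ; ∃; _×_; _,_; proj₁; proj₂)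
open import Data.Sum using (_⊎_)
open import Data.Empty using (⊥)
open import Relation.Nullary using (¬_)
open import Relation.Binary.PropositionalEquality using (_≡_; _≢_)

record Graph : Set where
  field
    n     : ℕ
    adj   : Fin n → Fin n → Bool
    sym   : ∀ u v → adj u v ≡ adj v u
    irrefl : ∀ v → adj v v ≡ false

module _ (G : Graph) where
  open Graph G

  V : Set
  V = Fin n

  Edge : V → V → Set
  Edge u v = adj u v ≡ true

  Sep : Set
  Sep = Subset n × Subset n

  inv : Sep → Sep
  inv (A , B) = (B , A)

  IsSep : Sep → Set
  IsSep (A , B) =
    (∀ v → v ∈ A ⊎ v ∈ B) ×
    (∀ u v → Edge u v → u ∈ A → u ∉ B → v ∈ B → v ∉ A → ⊥)

  order : Sep → ℕ
  order (A , B) = ∣ A ∩ B ∣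

  InS : ℕ → Sep → Set
  InS k s = IsSep s × order s < k

  _≤ₛ_ : Sep → Sep → Set
  (A , B) ≤ₛ (C , D) = (A ⊆ C) × (D ⊆ B)

  _<ₛ_ : Sep → Sep → Set
  s <ₛ t = (s ≤ₛ t) × (s ≢ t)

  SameUnoriented : Sep → Sep → Set
  SameUnoriented (A , B) (C , D) = ((A ≡ C) × (B ≡ D)) ⊎ ((A ≡ D) × (B ≡ C))

  IsOrientation : ℕ → (Sep → Set) → Set
  IsOrientation k O =
    (∀ s → O s → InS k s) ×
    (∀ s → InS k s → (O s ⊎ O (inv s)) × (O s → O (inv s) → s ≡ inv s))

  IsConsistent : ℕ → (Sep → Set) → Set
  IsConsistent k O =
    ∀ s t → InS k s → InS k t → ¬ SameUnoriented s t →
      s <ₛ t → O (inv s) → O t → ⊥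

  -- Finite sets of separations are given as duplicate-free lists.
  -- Stars and the family F_k^(2).

  IsStar : List Sep → Set
  IsStar σ =
    All (λ s → s ≢ inv s) σ ×
    (∀ s t → s ∈ₗ σ → t ∈ₗ σ → s ≢ t → s ≤ₛ inv t)

  bigB : List Sep → Subset n
  bigB = foldr (λ s acc → proj₂ s ∩ acc) ⊤

  InF2 : ℕ → List Sep → Set
  InF2 k σ =
    Unique σ × length σ ≤ 2 × All IsSep σ × IsStar σ × ∣ bigB σ ∣ < k

  IsTangle : ℕ → (Sep → Set) → Set
  IsTangle k O =
    IsOrientation k O × IsConsistent k O ×
    (∀ σ → InF2 k σ → All O σ → ⊥)

  HasTangle : ℕ → Set₁
  HasTangle k = Σ (Sep → Set) (IsTangle k)

  ∂ : Subset n → Subset n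
  ∂ X = tabulate (λ v → lookup X v ∧ any (λ w → adj v w ∧ not (lookup X w)) (allFin n))

  IsBlockage : ℕ → (Subset n → Set) → Set
  IsBlockage k 𝓑 =
    (∀ X → 𝓑 X → ∣ ∂ X ∣ < k) ×
    (∀ X X′ → 𝓑 X → X′ ⊆ X → ∣ ∂ X′ ∣ < k → 𝓑 X′) ×
    (∀ X₁ X₂ → InS k (X₁ , X₂) → (𝓑 X₁ ⊎ 𝓑 X₂) × ¬ (𝓑 X₁ × 𝓑 X₂))

  -- G has a blockage of order k - 1 (parametrised by k)
  HasBlockage : ℕ → Set₁
  HasBlockage k = Σ (Subset n → Set) (IsBlockage k)

data Walk {m : ℕ} (E : Fin m → Fin m → Set) : Fin m → Fin m → Set where
  here : ∀ {x} → Walk E x x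
  step : ∀ {x y z} → E x y → Walk E y z → Walk E x z

record Tree : Set where
  field
    m      : ℕ
    adjT   : Fin m → Fin m → Bool
    symT   : ∀ x y → adjT x y ≡ adjT y x
    irreflT : ∀ x → adjT x x ≡ false
    nonempty : 1 ≤ m
    connected : ∀ x y → Walk (λ a b → adjT a b ≡ true) x y
    acyclic : ∀ (x : Fin m) (xs : List (Fin m)) →
      Unique (x ∷ xs) → 3 ≤ length (x ∷ xs) →
      Linked (λ a b → adjT a b ≡ true) ((x ∷ xs) ++ [ x ]) → ⊥

module _ (G : Graph) where
  open Graph G

  -- S_k-tree over F_k^(2); α is given on all ordered pairs, but only its
  -- values on (ordered) edges of T are constrained/relevant.
  record SkTree (k : ℕ) : Set where
    field
      T : Tree
    open Tree T
    field
      α : Fin m → Fin m → Sep G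
      α-in : ∀ x y → adjT x y ≡ true → InS G k (α x y)
      α-inv : ∀ x y → adjT x y ≡ true → α y x ≡ inv G (α x y)
      α-star : ∀ t → Σ (List (Sep G)) λ σ →
        (∀ s → (s ∈ₗ σ → ∃ λ x → (adjT x t ≡ true) × α x t ≡ s) ×
               ((∃ λ x → (adjT x t ≡ true) × α x t ≡ s) → s ∈ₗ σ)) ×
        InF2 G k σ

  record PathDecomposition : Set where
    field
      r : ℕ
      W : Fin r → Subset n
      coversV : ∀ v → ∃ λ i → v ∈ W i
      coversE : ∀ u v → adj u v ≡ true → ∃ λ i → (u ∈ W i) × (v ∈ W i)
      interp : ∀ i j l → i ≤ᶠ j → j ≤ᶠ l → (W i ∩ W l) ⊆ W j

  bigMax : ∀ {r} → (Fin r → ℕ) → ℕ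
  bigMax {zero} f = 0
  bigMax {suc r} f = f fzero ⊔ bigMax (λ i → f (fsuc i))

  width : PathDecomposition → ℕ
  width D = bigMax (λ i → ∣ W i ∣ ∸ 1)
    where open PathDecomposition D

  PathWidthAtLeast : ℕ → Set
  PathWidthAtLeast p = ∀ (D : PathDecomposition) → p ≤ width D

{-# OPTIONS --safe #-}
-- Call a chain (∅ , V) = s₀ ≤ … ≤ s_l = (V , ∅) in S_k whose steps change one side only a sweep. The bags A ∩ B of a
-- sweep form a path-decomposition of width < k - 1, every such path-decomposition comes from a sweep, and the sweep
-- itself labels an S_k-tree which is a path. If there is no sweep, process the separations s in increasing order: put
-- inv s into the tangle if some sweep leads from an element already chosen to inv s, and s otherwise. That this never
-- creates a sweep from a chosen element to the inverse of a chosen one follows by submodularity: two sweeps ending and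
-- starting at nested x ≤ u can be shifted onto a separation of least order between x and u and concatenated there.
-- Conversely, a tangle directs the edges of an S_k-tree such that no node is a sink, so following the directions gives
-- a cycle. Blockages and tangles determine each other through X ↦ (X , (V ∖ X) ∪ ∂ X).
module Submission where

open import Defs
open import Data.Nat using (ℕ; zero; suc; _+_; _∸_; _≤_; _<_; _≟_; _<?_; _≤?_; _≤′_; ≤′-refl; ≤′-step; z≤n; s≤s)
open import Data.Nat.Properties using
  ( ≤-refl; ≤-reflexive; ≤-trans; ≤-antisym; ≤-pred; <-irrefl; <-trans; ≤-<-trans; <-≤-trans; <⇒≤; <⇒≱; ≤⇒≯; ≮⇒≥; ≤⇒≤′
  ; n<1+n; n≤1+n; 1+n≢n; m+1+n≰m; m<n⇒m<1+n; suc-injective; +-suc; +-identityʳ; +-mono-≤; +-monoʳ-≤; +-cancelʳ-≤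
  ; +-commutativeSemigroup; m<n⇒0<n∸m; m+[n∸m]≡n; ⊔-lub; m≤m⊔n; m≤n⊔m; module ≤-Reasoning )
open import Algebra.Properties.CommutativeSemigroup +-commutativeSemigroup using (interchange)
open import Data.Nat.Induction using (<-wellFounded)
open import Induction.WellFounded using (Acc; acc)
open import Data.Bool using (Bool; true; false; not; _∧_; _∨_)
open import Data.Bool.ListAction using (any)
open import Data.Bool.Properties using (T-≡; ∨-comm; ¬-not) renaming (_≟_ to _≟ᵇ_)
open import Data.Fin using (Fin; zero; suc; toℕ; fromℕ<; inject₁)
open import Data.Fin.Induction using (<-weakInduction)
import Data.Fin.Properties as Fin
open import Data.Fin.Subset
open import Data.Fin.Subset.Properties
open import Data.Vec using ([]; _∷_; here; there; lookup; tabulate)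
open import Data.Vec.Properties using (lookup∘tabulate; lookup⇒[]=; []=⇒lookup; ≡-dec)
open import Data.List using (List; []; _∷_; _++_; map; length; allFin; cartesianProduct)
open import Data.List.Membership.Propositional using (lose) renaming (_∈_ to _∈ₗ_)
open import Data.List.Membership.Propositional.Properties
  using (∈-map⁺; ∈-++⁺ˡ; ∈-++⁺ʳ; ∈-cartesianProduct⁺; ∈-allFin)
open import Data.List.Relation.Unary.All as All using (All; []; _∷_)
open import Data.List.Relation.Unary.AllPairs using ([]; _∷_)
open import Data.List.Relation.Unary.Any as Any using (here; there)
open import Data.List.Relation.Unary.Any.Properties using (any⁺; any⁻)
open import Data.List.Relation.Unary.Linked using (Linked; [-]; _∷_)
open import Data.List.Relation.Unary.Unique.Propositional using (Unique)
open import Data.Product as Product using (Σ; ∃; _×_; _,_; proj₁; proj₂)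
import Data.Product.Properties as Product using (≡-dec)
open import Data.Sum as Sum using (_⊎_; inj₁; inj₂; swap; [_,_]′; fromInj₁; fromInj₂)
open import Data.Empty using () renaming (⊥ to Absurd)
open import Function using (id)
open import Function.Bundles using (_⇔_; mk⇔; module Equivalence)
open import Relation.Nullary using (¬_; contradiction; Dec; yes; no; does)
open import Relation.Nullary.Decidable
  using (_×-dec_; _⊎-dec_; _→-dec_; ¬?; map′; dec-true; dec-false; decidable-stable)
open import Relation.Unary using (Decidable)
open import Relation.Binary.PropositionalEquality
  using (_≡_; _≢_; refl; sym; trans; cong; cong₂; subst; subst₂)
open import Relation.Binary.Construct.Closure.ReflexiveTransitive using (Star; ε; _◅_; _◅◅_; return)

-- Finite sets and submodularity of the order

comprehension : ∀ {m} {P : Fin m → Set} → Decidable P → Subset m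
comprehension P? = tabulate (λ v → does (P? v))

module _ {m} {P : Fin m → Set} (P? : Decidable P) where

  ∈-comprehension⁺ : ∀ {v} → P v → v ∈ comprehension P?
  ∈-comprehension⁺ {v} p =
    lookup⇒[]= v _ (trans (lookup∘tabulate _ v) (dec-true (P? v) p))

  ∈-comprehension⁻ : ∀ {v} → v ∈ comprehension P? → P v
  ∈-comprehension⁻ {v} v∈
    with P? v | trans (sym (lookup∘tabulate (λ w → does (P? w)) v)) ([]=⇒lookup v∈)
  ... | yes p | _ = p
  ... | no _  | ()

⊆⇒⊂⊎≡ : ∀ {m} {p q : Subset m} → p ⊆ q → p ⊂ q ⊎ p ≡ q
⊆⇒⊂⊎≡ {p = p} {q} p⊆q with p ⊂? q
... | yes p⊂q = inj₁ p⊂q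
... | no p⊄q  = inj₂ (⊆-antisym p⊆q λ {v} v∈q →
        decidable-stable (v ∈? p) λ v∉p → p⊄q (p⊆q , v , v∈q , v∉p))

∁-involutive : ∀ {m} (p : Subset m) → ∁ (∁ p) ≡ p
∁-involutive p = ⊆-antisym (λ v∈ → x∉∁p⇒x∈p (x∈∁p⇒x∉p v∈)) (λ v∈ → x∉p⇒x∈∁p (x∈p⇒x∉∁p v∈))

weight : Side → ℕ
weight inside  = 1
weight outside = 0

∣∷∣ : ∀ {m} x (p : Subset m) → ∣ x ∷ p ∣ ≡ weight x + ∣ p ∣
∣∷∣ inside  p = refl
∣∷∣ outside p = refl

-- Submodularity is checked one vertex at a time. A vertex covered by both pairs contributes equally
-- to both sides; any other vertex can only make the left side smaller.
weight-submodular : ∀ a b c d →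
  weight ((a ∧ c) ∧ (b ∨ d)) + weight ((a ∨ c) ∧ (b ∧ d)) ≤ weight (a ∧ b) + weight (c ∧ d)
weight-submodular false false false d     = z≤n
weight-submodular false false true  d     = z≤n
weight-submodular false true  false d     = z≤n
weight-submodular false true  true  false = z≤n
weight-submodular false true  true  true  = ≤-refl
weight-submodular true  false false d     = z≤n
weight-submodular true  false true  false = z≤n
weight-submodular true  false true  true  = ≤-refl
weight-submodular true  true  false false = z≤n
weight-submodular true  true  false true  = ≤-refl
weight-submodular true  true  true  false = ≤-refl
weight-submodular true  true  true  true  = ≤-refl

∣∩∣-submodular : ∀ {m} (A B C D : Subset m) →
  ∣ (A ∩ C) ∩ (B ∪ D) ∣ + ∣ (A ∪ C) ∩ (B ∩ D) ∣ ≤ ∣ A ∩ B ∣ + ∣ C ∩ D ∣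
∣∩∣-submodular [] [] [] [] = z≤n
∣∩∣-submodular (a ∷ A) (b ∷ B) (c ∷ C) (d ∷ D) = begin
  ∣ x₁ ∷ X₁ ∣ + ∣ x₂ ∷ X₂ ∣                      ≡⟨ expand x₁ x₂ X₁ X₂ ⟩
  (weight x₁ + weight x₂) + (∣ X₁ ∣ + ∣ X₂ ∣)
    ≤⟨ +-mono-≤ (weight-submodular a b c d) (∣∩∣-submodular A B C D) ⟩
  (weight (a ∧ b) + weight (c ∧ d)) + (∣ A ∩ B ∣ + ∣ C ∩ D ∣)
    ≡⟨ expand (a ∧ b) (c ∧ d) (A ∩ B) (C ∩ D) ⟨
  ∣ (a ∧ b) ∷ (A ∩ B) ∣ + ∣ (c ∧ d) ∷ (C ∩ D) ∣  ∎
  where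
  open ≤-Reasoning
  x₁ = (a ∧ c) ∧ (b ∨ d)
  x₂ = (a ∨ c) ∧ (b ∧ d)
  X₁ = (A ∩ C) ∩ (B ∪ D)
  X₂ = (A ∪ C) ∩ (B ∩ D)

  expand : ∀ {m} x y (p q : Subset m) →
    ∣ x ∷ p ∣ + ∣ y ∷ q ∣ ≡ (weight x + weight y) + (∣ p ∣ + ∣ q ∣)
  expand x y p q = trans (cong₂ _+_ (∣∷∣ x p) (∣∷∣ y q)) (interchange (weight x) (∣ p ∣) (weight y) (∣ q ∣))

-- The truncation `0 ∸ 1 = 0` is the critical case: an empty bag meets a width bound below `k ∸ 1`
-- only if `k ∸ 1` is positive.
pred-<-pred : ∀ {m k} → 1 < k → m < k → m ∸ 1 < k ∸ 1
pred-<-pred {zero}  (s≤s 0<k) _         = 0<k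
pred-<-pred {suc m} _         (s≤s m<k) = m<k

pred-<-pred⁻ : ∀ {m k} → 0 < k → m ∸ 1 < k ∸ 1 → m < k
pred-<-pred⁻ {zero}  0<k _ = 0<k
pred-<-pred⁻ {suc m} 0<k p = subst (suc m <_) (m+[n∸m]≡n 0<k) (s≤s p)

-- Deciding reachability and exhausting all subsets

module _ {A : Set} {R : A → A → Set} (_≟_ : (x y : A) → Dec (x ≡ y)) (R? : ∀ x y → Dec (R x y)) where

  -- Floyd–Warshall: reachability by walks whose inner vertices are listed.
  Via : List A → A → A → Set
  Via []      a b = (a ≡ b) ⊎ R a b
  Via (x ∷ L) a b = Via L a b ⊎ (Via L a x × Via L x b)

  via? : ∀ L a b → Dec (Via L a b)
  via? []      a b = (a ≟ b) ⊎-dec R? a b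
  via? (x ∷ L) a b = via? L a b ⊎-dec (via? L a x ×-dec via? L x b)

  via⇒star : ∀ L {a b} → Via L a b → Star R a b
  via⇒star []      (inj₁ refl)    = ε
  via⇒star []      (inj₂ r)       = return r
  via⇒star (x ∷ L) (inj₁ p)       = via⇒star L p
  via⇒star (x ∷ L) (inj₂ (p , q)) = via⇒star L p ◅◅ via⇒star L q

  via-base : ∀ L {a b} → (a ≡ b) ⊎ R a b → Via L a b
  via-base []      r = r
  via-base (x ∷ L) r = inj₁ (via-base L r)

  -- Closed detours are cut out: if the junction is `y`, each half drops its loop at `y`; if both
  -- halves pass through `y`, everything between the two visits is dropped.
  via-trans : ∀ L {a b x} → x ∈ₗ L → Via L a x → Via L x b → Via L a b
  via-trans (y ∷ L) (here refl) p q = inj₂ (to p , from q)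
    where
    to : ∀ {a} → Via (y ∷ L) a y → Via L a y
    to (inj₁ p)       = p
    to (inj₂ (p , _)) = p
    from : ∀ {b} → Via (y ∷ L) y b → Via L y b
    from (inj₁ p)       = p
    from (inj₂ (_ , p)) = p
  via-trans (y ∷ L) (there x∈) (inj₁ p)       (inj₁ q)       = inj₁ (via-trans L x∈ p q)
  via-trans (y ∷ L) (there x∈) (inj₁ p)       (inj₂ (q , r)) = inj₂ (via-trans L x∈ p q , r)
  via-trans (y ∷ L) (there x∈) (inj₂ (p , q)) (inj₁ r)       = inj₂ (p , via-trans L x∈ q r)
  via-trans (y ∷ L) (there x∈) (inj₂ (p , _)) (inj₂ (_ , r)) = inj₂ (p , r)

  star? : ∀ L → (∀ x → x ∈ₗ L) → ∀ a b → Dec (Star R a b)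
  star? L full a b = map′ (via⇒star L) star⇒via (via? L a b)
    where
    star⇒via : ∀ {a b} → Star R a b → Via L a b
    star⇒via ε        = via-base L (inj₁ refl)
    star⇒via (r ◅ rs) = via-trans L (full _) (via-base L (inj₂ r)) (star⇒via rs)

subsets : ∀ m → List (Subset m)
subsets zero    = [] ∷ []
subsets (suc m) = map (outside ∷_) (subsets m) ++ map (inside ∷_) (subsets m)

∈-subsets : ∀ {m} (p : Subset m) → p ∈ₗ subsets m
∈-subsets []            = here refl
∈-subsets (outside ∷ p) = ∈-++⁺ˡ (∈-map⁺ (outside ∷_) (∈-subsets p))
∈-subsets (inside ∷ p)  = ∈-++⁺ʳ _ (∈-map⁺ (inside ∷_) (∈-subsets p))

-- A state is extended until it has dealt with every subset, taking each subset after its proper subsets.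
saturate : ∀ {ℓ} {St : Set ℓ} (_≼_ : St → St → Set) →
  (∀ {x} → x ≼ x) → (∀ {x y z} → x ≼ y → y ≼ z → x ≼ z) →
  ∀ m (D : St → Subset m → Set) → (∀ {x y} p → x ≼ y → D x p → D y p) →
  (∀ x p → (∀ q → q ⊂ p → D x q) → ∃ λ y → x ≼ y × D y p) →
  ∀ x → ∃ λ y → x ≼ y × (∀ p → D y p)
saturate _≼_ rfl trn zero D mono next x
  with y , x≼y , d ← next x [] (λ { [] (_ , () , _) })
  = y , x≼y , λ { [] → d }
saturate {St = St} _≼_ rfl trn (suc m) D mono next x
  with y , x≼y , dy ← saturate _≼_ rfl trn m (λ x p → D x (outside ∷ p)) (λ p → mono (outside ∷ p))
    (λ x p all → next x (outside ∷ p) λ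
      { (outside ∷ q) q⊂p → all q (drop-∷-⊂ q⊂p)
      ; (inside ∷ q) (q⊆p , _) → contradiction (q⊆p here) λ () }) x
  -- The second recursion treats the subsets containing the first element. Its states carry a proof
  -- that all subsets without that element are dealt with, since some of these are proper subsets
  -- too.
  with (z , _) , y≼z , dz ← saturate {St = ∃ λ x → ∀ p → D x (outside ∷ p)} (λ x y → proj₁ x ≼ proj₁ y)
    rfl trn m (λ x p → D (proj₁ x) (inside ∷ p)) (λ p → mono (inside ∷ p))
    (λ (x , dx) p all →
      let y , x≼y , d = next x (inside ∷ p) λ
            { (outside ∷ q) _ → dx q
            ; (inside ∷ q) q⊂p → all q (drop-∷-⊂ q⊂p) }
      in (y , λ q → mono (outside ∷ q) x≼y (dx q)) , x≼y , d) (y , dy)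
  = z , trn x≼y y≼z , λ
      { (outside ∷ p) → mono (outside ∷ p) y≼z (dy p)
      ; (inside ∷ p) → dz p }

does-true : ∀ {P : Set} (P? : Dec P) → does P? ≡ true → P
does-true (yes p) _ = p

-- Paths and cycles in trees

module _ {m} {E : Fin m → Fin m → Set} where

  walk-trans : ∀ {x y z} → Walk E x y → Walk E y z → Walk E x z
  walk-trans here       w′ = w′
  walk-trans (step e w) w′ = step e (walk-trans w w′)

  walk-sym : (∀ {x y} → E x y → E y x) → ∀ {x y} → Walk E x y → Walk E y x
  walk-sym flip here       = here
  walk-sym flip (step e w) = walk-trans (walk-sym flip w) (step (flip e) here)

module _ {N : ℕ} where

  Consecutive : Fin N → Fin N → Set
  Consecutive x y = suc (toℕ x) ≡ toℕ y ⊎ suc (toℕ y) ≡ toℕ x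

  consecutive? : ∀ x y → Dec (Consecutive x y)
  consecutive? x y = (suc (toℕ x) ≟ toℕ y) ⊎-dec (suc (toℕ y) ≟ toℕ x)

  private
    Linked′ : List (Fin N) → Set
    Linked′ = Linked λ x y → does (consecutive? x y) ≡ true

  -- A walk on a path that repeats no vertex cannot turn round, as turning at `y` would revisit `x`.
  -- Only the closing step to `z` may go down, which costs the bound one.
  ascend : ∀ x y ys z → suc (toℕ x) ≡ toℕ y → Unique (x ∷ y ∷ ys) → Linked′ ((y ∷ ys) ++ z ∷ []) →
    toℕ x + length ys ≤ toℕ z
  ascend x y [] z x<y _ (yz ∷ _) rewrite +-identityʳ (toℕ x) with does-true (consecutive? y z) yz
  ... | inj₁ y<z = <⇒≤ (≤-trans (≤-reflexive x<y) (≤-trans (n≤1+n _) (≤-reflexive y<z)))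
  ... | inj₂ z<y = ≤-reflexive (suc-injective (trans x<y (sym z<y)))
  ascend x y (w ∷ ws) z x<y ((_ ∷ x≢w ∷ _) ∷ uniq) (yw ∷ linked) with does-true (consecutive? y w) yw
  ... | inj₁ y<w = subst (_≤ toℕ z) (trans (cong (_+ length ws) (sym x<y)) (sym (+-suc (toℕ x) _)))
                     (ascend y w ws z y<w uniq linked)
  ... | inj₂ w<y = contradiction (Fin.toℕ-injective (suc-injective (trans x<y (sym w<y)))) x≢w

  descend : ∀ x y ys z → suc (toℕ y) ≡ toℕ x → Unique (x ∷ y ∷ ys) → Linked′ ((y ∷ ys) ++ z ∷ []) →
    toℕ z + length ys ≤ toℕ x
  descend x y [] z y<x _ (yz ∷ _) rewrite +-identityʳ (toℕ z) with does-true (consecutive? y z) yz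
  ... | inj₁ y<z = ≤-reflexive (trans (sym y<z) y<x)
  ... | inj₂ z<y = <⇒≤ (≤-trans (≤-reflexive z<y) (≤-trans (n≤1+n _) (≤-reflexive y<x)))
  descend x y (w ∷ ws) z y<x ((_ ∷ x≢w ∷ _) ∷ uniq) (yw ∷ linked) with does-true (consecutive? y w) yw
  ... | inj₁ y<w = contradiction (Fin.toℕ-injective (trans (sym y<x) y<w)) x≢w
  ... | inj₂ w<y = subst₂ _≤_ (sym (+-suc (toℕ z) _)) y<x (s≤s (descend y w ws z w<y uniq linked))

pathTree : ℕ → Tree
pathTree N = record
  { m         = suc N
  ; adjT      = λ x y → does (consecutive? x y)
  ; symT      = λ x y → ∨-comm (does (suc (toℕ x) ≟ toℕ y)) _
  ; irreflT   = λ x → dec-false (consecutive? x x) [ 1+n≢n , 1+n≢n ]′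
  ; nonempty  = s≤s z≤n
  ; connected = λ x y → walk-trans (toZero x) (walk-sym (λ {x} {y} → flip x y) (toZero y))
  ; acyclic   = acyclic′
  }
  where
  flip : ∀ x y → does (consecutive? {suc N} x y) ≡ true → does (consecutive? y x) ≡ true
  flip x y e = trans (∨-comm (does (suc (toℕ y) ≟ toℕ x)) _) e

  toZero : ∀ x → Walk (λ x y → does (consecutive? {suc N} x y) ≡ true) x zero
  toZero = <-weakInduction _ here λ i w → step
    (dec-true (consecutive? (suc i) (inject₁ i)) (inj₂ (cong suc (Fin.toℕ-inject₁ i)))) w

  acyclic′ : ∀ (x : Fin (suc N)) xs → Unique (x ∷ xs) → 3 ≤ length (x ∷ xs) →
    Linked (λ x y → does (consecutive? x y) ≡ true) ((x ∷ xs) ++ x ∷ []) → Absurd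
  acyclic′ x (_ ∷ []) _ (s≤s (s≤s ())) _
  acyclic′ x (y ∷ w ∷ ws) uniq _ (xy ∷ linked) with does-true (consecutive? x y) xy
  -- The walk closes at `z = x`, yet it has at least the vertex `w` after `y`, so the bound puts `x`
  -- above itself.
  ... | inj₁ x<y = m+1+n≰m (toℕ x) (ascend x y (w ∷ ws) x x<y uniq linked)
  ... | inj₂ y<x = m+1+n≰m (toℕ x) (descend x y (w ∷ ws) x y<x uniq linked)

module _ {A : Set} (f : A → A) where

  iter : ℕ → A → A
  iter zero    x = x
  iter (suc i) x = iter i (f x)

  orbit : ℕ → A → List A
  orbit zero    x = []
  orbit (suc i) x = x ∷ orbit i (f x)

  iter-+ : ∀ i j x → iter (i + j) x ≡ iter j (iter i x)
  iter-+ zero    j x = refl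
  iter-+ (suc i) j x = iter-+ i j (f x)

  length-orbit : ∀ i x → length (orbit i x) ≡ i
  length-orbit zero    x = refl
  length-orbit (suc i) x = cong suc (length-orbit i (f x))

  orbit-linked : ∀ {R : A → A → Set} → (∀ x → R x (f x)) → ∀ i x → Linked R (orbit i x ++ iter i x ∷ [])
  orbit-linked Rf zero          x = [-]
  orbit-linked Rf (suc zero)    x = Rf x ∷ [-]
  orbit-linked Rf (suc (suc i)) x = Rf x ∷ orbit-linked Rf (suc i) (f x)

  all-orbit : ∀ {P : A → Set} i x → (∀ j → j < i → P (iter j x)) → All P (orbit i x)
  all-orbit zero    x Pj = []
  all-orbit (suc i) x Pj = Pj 0 (s≤s z≤n) ∷ all-orbit i (f x) (λ j j<i → Pj (suc j) (s≤s j<i))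

  -- If the head recurred in the tail, it would be a point of period less than the length; the tail
  -- is again an orbit.
  orbit-unique : ∀ i → (∀ j → 0 < j → j < i → ∀ x → iter j x ≢ x) → ∀ x → Unique (orbit i x)
  orbit-unique zero    _        x = []
  orbit-unique (suc i) aperiodic x =
    all-orbit i (f x) (λ j j<i e → aperiodic (suc j) (s≤s z≤n) (s≤s j<i) x (sym e)) ∷
    orbit-unique i (λ j 0<j j<i → aperiodic j 0<j (m<n⇒m<1+n j<i)) (f x)

-- Otherwise a least period of f would give a cycle.
tree-turns-back : (T : Tree) (f : Fin (Tree.m T) → Fin (Tree.m T)) →
  (∀ x → Tree.adjT T x (f x) ≡ true) → ¬ (∀ x → f (f x) ≢ x)
tree-turns-back T f adjacent forward
  -- Among `m + 1` iterates of one node two agree, and the earlier one is then a point of period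
  -- `j - i`.
  with i , j , i<j , e ← Fin.pigeonhole (n<1+n (Tree.m T)) (λ i → iter f (toℕ i) (fromℕ< (Tree.nonempty T)))
  = aperiodic _ (<-wellFounded _) (m<n⇒0<n∸m i<j) _ (trans
      (sym (iter-+ f (toℕ i) (toℕ j ∸ toℕ i) (fromℕ< (Tree.nonempty T))))
      (trans (cong (λ l → iter f l _) (m+[n∸m]≡n (<⇒≤ i<j))) (sym e)))
  where
  open Tree T
  aperiodic : ∀ p → Acc _<_ p → 0 < p → ∀ x → iter f p x ≢ x
  aperiodic (suc zero) _ _ x fx≡x with () ← trans (sym (irreflT x)) (subst (λ y → adjT x y ≡ true) fx≡x (adjacent x))
  aperiodic (suc (suc zero)) _ _ x = forward x
  -- No node has a smaller period, so the orbit consists of `p ≥ 3` distinct nodes and closes up to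
  -- a cycle.
  aperiodic p@(suc (suc (suc q))) (acc smaller) _ x e = acyclic x (orbit f (suc (suc q)) (f x))
    (orbit-unique f p (λ j 0<j j<p → aperiodic j (smaller j<p) 0<j) x)
    (subst (3 ≤_) (sym (length-orbit f p x)) (s≤s (s≤s (s≤s z≤n))))
    (subst (λ y → Linked _ (orbit f p x ++ y ∷ [])) e (orbit-linked f adjacent p x))

module _ (G : Graph) where
  open Graph G using (n; adj)

  -- The lattice of separations

  infix 4 _≼_
  infixr 7 _⊓_
  infixr 6 _⊔_

  _≼_ : Sep G → Sep G → Set
  s ≼ t = _≤ₛ_ G s t

  _⊓_ _⊔_ : Sep G → Sep G → Sep G
  (A , B) ⊓ (C , D) = A ∩ C , B ∪ D
  (A , B) ⊔ (C , D) = A ∪ C , B ∩ D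

  bot : Sep G
  bot = ⊥ , ⊤

  ≼-refl : ∀ {s} → s ≼ s
  ≼-refl = ⊆-refl , ⊆-refl

  ≼-trans : ∀ {s t u} → s ≼ t → t ≼ u → s ≼ u
  ≼-trans (p , q) (p′ , q′) = ⊆-trans p p′ , ⊆-trans q′ q

  ≼-antisym : ∀ {s t} → s ≼ t → t ≼ s → s ≡ t
  ≼-antisym (p , q) (p′ , q′) = cong₂ _,_ (⊆-antisym p p′) (⊆-antisym q′ q)

  ≼-inv : ∀ {s t} → s ≼ t → inv G t ≼ inv G s
  ≼-inv (p , q) = q , p

  bot-min : ∀ {s} → bot ≼ s
  bot-min {A , B} = ⊆-min A , ⊆-max B

  ⊓-lower₁ : ∀ s t → s ⊓ t ≼ s
  ⊓-lower₁ (A , B) (C , D) = p∩q⊆p A C , p⊆p∪q D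

  ⊓-lower₂ : ∀ s t → s ⊓ t ≼ t
  ⊓-lower₂ (A , B) (C , D) = p∩q⊆q A C , q⊆p∪q B D

  ⊓-greatest : ∀ {r} s t → r ≼ s → r ≼ t → r ≼ s ⊓ t
  ⊓-greatest (A , B) (C , D) (p , q) (p′ , q′) =
    (λ x∈ → x∈p∩q⁺ (p x∈ , p′ x∈)) ,
    λ x∈ → [ q , q′ ]′ (x∈p∪q⁻ B D x∈)

  order-inv : ∀ s → order G (inv G s) ≡ order G s
  order-inv (A , B) = cong ∣_∣ (∩-comm B A)

  isSep-inv : ∀ {s} → IsSep G s → IsSep G (inv G s)
  isSep-inv (cover , noEdge) =
    (λ v → swap (cover v)) ,
    λ u v e u∈B u∉A v∈A v∉B → noEdge v u (trans (Graph.sym G v u) e) v∈A v∉B u∈B u∉A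

  -- An edge that leaves `A ∩ C` leaves `A` or `C`, and so would cross one of the two given
  -- separations.
  isSep-⊓ : ∀ s t → IsSep G s → IsSep G t → IsSep G (s ⊓ t)
  isSep-⊓ (A , B) (C , D) (cover , noEdge) (cover′ , noEdge′) = cov , noE
    where
    cov : ∀ v → v ∈ A ∩ C ⊎ v ∈ B ∪ D
    cov v with cover v | cover′ v
    ... | inj₁ v∈A | inj₁ v∈C = inj₁ (x∈p∩q⁺ (v∈A , v∈C))
    ... | inj₂ v∈B | _        = inj₂ (x∈p∪q⁺ (inj₁ v∈B))
    ... | inj₁ _   | inj₂ v∈D = inj₂ (x∈p∪q⁺ (inj₂ v∈D))
    noE : ∀ u v → Edge G u v → u ∈ A ∩ C → u ∉ B ∪ D → v ∈ B ∪ D → v ∉ A ∩ C → Absurd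
    noE u v e u∈ u∉ _ v∉ with x∈p∩q⁻ A C u∈ | v ∈? A | v ∈? C
    ... | _ , _     | yes v∈A | yes v∈C = v∉ (x∈p∩q⁺ (v∈A , v∈C))
    ... | u∈A , _   | no v∉A  | _       = noEdge u v e u∈A (λ u∈B → u∉ (x∈p∪q⁺ (inj₁ u∈B)))
                                            (fromInj₂ (λ v∈A → contradiction v∈A v∉A) (cover v)) v∉A
    ... | _ , u∈C   | yes _   | no v∉C  = noEdge′ u v e u∈C (λ u∈D → u∉ (x∈p∪q⁺ (inj₂ u∈D)))
                                            (fromInj₂ (λ v∈C → contradiction v∈C v∉C) (cover′ v)) v∉C

  isSep-⊔ : ∀ s t → IsSep G s → IsSep G t → IsSep G (s ⊔ t)
  isSep-⊔ s t S T = isSep-inv (isSep-⊓ (inv G s) (inv G t) (isSep-inv S) (isSep-inv T))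

  isSep? : Decidable (IsSep G)
  isSep? (A , B) =
    Fin.all? (λ v → (v ∈? A) ⊎-dec (v ∈? B)) ×-dec
    Fin.all? (λ u → Fin.all? λ v → (adj u v ≟ᵇ true) →-dec ((u ∈? A) →-dec (¬? (u ∈? B) →-dec
      ((v ∈? B) →-dec ¬? (¬? (v ∈? A))))))

  bot-isSep : IsSep G bot
  bot-isSep = (λ _ → inj₂ ∈⊤) , λ _ _ _ u∈⊥ → contradiction u∈⊥ ∉⊥

  _≟ₛ_ : (s t : Sep G) → Dec (s ≡ t)
  _≟ₛ_ = Product.≡-dec (≡-dec _≟ᵇ_) (≡-dec _≟ᵇ_)

  _≼?_ : ∀ s t → Dec (s ≼ t)
  (A , B) ≼? (C , D) = (A ⊆? C) ×-dec (D ⊆? B)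

  order-bot : order G bot ≡ 0
  order-bot = trans (cong (∣_∣ {n}) (∩-zeroˡ ⊤)) (∣⊥∣≡0 n)

  -- The middle separation shares a side with s and with t.
  isSep-middle : ∀ s t → s ≼ t → IsSep G s → IsSep G t → IsSep G (proj₁ t , proj₂ s)
  isSep-middle (A , B) (C , D) (A⊆C , D⊆B) (cover , noEdge) (cover′ , noEdge′) = cov , noE
    where
    cov : ∀ v → v ∈ C ⊎ v ∈ B
    cov v with cover v
    ... | inj₁ v∈A = inj₁ (A⊆C v∈A)
    ... | inj₂ v∈B = inj₂ v∈B
    noE : ∀ u v → Edge G u v → u ∈ C → u ∉ B → v ∈ B → v ∉ C → Absurd
    noE u v e u∈C u∉B v∈B v∉C with cover u
    ... | inj₁ u∈A = noEdge u v e u∈A u∉B v∈B (λ v∈A → v∉C (A⊆C v∈A))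
    ... | inj₂ u∈B = u∉B u∈B

  bigMax-< : ∀ {r b} (f : Fin r → ℕ) → 0 < b → (∀ i → f i < b) → bigMax G f < b
  bigMax-< {zero}  f 0<b _   = 0<b
  bigMax-< {suc r} f 0<b f<b = ⊔-lub (f<b zero) (bigMax-< (λ i → f (suc i)) 0<b (λ i → f<b (suc i)))

  ≤-bigMax : ∀ {r} (f : Fin r → ℕ) i → f i ≤ bigMax G f
  ≤-bigMax f zero    = m≤m⊔n (f zero) _
  ≤-bigMax f (suc i) = ≤-trans (≤-bigMax (λ i → f (suc i)) i) (m≤n⊔m (f zero) _)

  -- Sweeps: reversing, shifting and indexing them

  module _ (k : ℕ) where

    infix 4 _⟶_ _⟶*_

    -- Changing one side at a time makes every bag of a sweep the intersection A ∩ B of a single separation.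
    _⟶_ _⟶*_ : Sep G → Sep G → Set
    s ⟶ t = InS G k s × InS G k t ×
      ((proj₁ s ⊆ proj₁ t × proj₂ s ≡ proj₂ t) ⊎ (proj₁ s ≡ proj₁ t × proj₂ t ⊆ proj₂ s))
    _⟶*_ = Star _⟶_

    inS-inv : ∀ {s} → InS G k s → InS G k (inv G s)
    inS-inv {s} (S , o) = isSep-inv S , subst (_< k) (sym (order-inv s)) o

    inS? : Decidable (InS G k)
    inS? s = isSep? s ×-dec (order G s <? k)

    _⟶?_ : ∀ s t → Dec (s ⟶ t)
    (A , B) ⟶? (C , D) = inS? (A , B) ×-dec inS? (C , D) ×-dec
      (((A ⊆? C) ×-dec (≡-dec _≟ᵇ_ B D)) ⊎-dec ((≡-dec _≟ᵇ_ A C) ×-dec (D ⊆? B)))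

    _⟶*?_ : ∀ s t → Dec (s ⟶* t)
    _⟶*?_ = star? _≟ₛ_ _⟶?_ (cartesianProduct (subsets n) (subsets n))
      (λ (A , B) → ∈-cartesianProduct⁺ (∈-subsets A) (∈-subsets B))

    ⟶⇒≼ : ∀ {s t} → s ⟶ t → s ≼ t
    ⟶⇒≼ (_ , _ , inj₁ (p , refl)) = p , ⊆-refl
    ⟶⇒≼ (_ , _ , inj₂ (refl , q)) = ⊆-refl , q

    ⟶*⇒≼ : ∀ {s t} → s ⟶* t → s ≼ t
    ⟶*⇒≼ ε        = ≼-refl
    ⟶*⇒≼ (r ◅ rs) = ≼-trans (⟶⇒≼ r) (⟶*⇒≼ rs)

    ⟶-inv : ∀ {s t} → s ⟶ t → inv G t ⟶ inv G s
    ⟶-inv (S , T , inj₁ (p , e)) = inS-inv T , inS-inv S , inj₂ (sym e , p)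
    ⟶-inv (S , T , inj₂ (e , q)) = inS-inv T , inS-inv S , inj₁ (q , sym e)

    ⟶*-inv : ∀ {s t} → s ⟶* t → inv G t ⟶* inv G s
    ⟶*-inv ε        = ε
    ⟶*-inv (r ◅ rs) = ⟶*-inv rs ◅◅ return (⟶-inv r)

    -- The bag is the separator of the middle separation, so one step enlarges the left side and a
    -- second one shrinks the right side. Two-element stars and bags of path-decompositions become
    -- sweeps in this way.
    ⟶*-bag : ∀ s t → s ≼ t → InS G k s → InS G k t → ∣ proj₂ s ∩ proj₁ t ∣ < k → s ⟶* t
    ⟶*-bag s t s≼t S T bag = (S , M , inj₁ (proj₁ s≼t , refl)) ◅ (M , T , inj₂ (refl , proj₂ s≼t)) ◅ ε
      where
      M : InS G k (proj₁ t , proj₂ s)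
      M = isSep-middle s t s≼t (proj₁ S) (proj₁ T) ,
          subst (_< k) (cong ∣_∣ (∩-comm (proj₂ s) (proj₁ t))) bag

    module Shift {x u z : Sep G} (Z : InS G k z) (x≼z : x ≼ z) (z≼u : z ≼ u)
      (minimal : ∀ w → IsSep G w → x ≼ w → w ≼ u → order G z ≤ order G w) where

      -- The join `c ⊔ z` lies between `x` and `u`, so its order is at least that of `z`; by
      -- submodularity the order of `c ⊓ z` is then at most that of `c`.
      inS-⊓ : ∀ c → InS G k c → c ≼ u → InS G k (c ⊓ z)
      inS-⊓ c (C , o) c≼u = isSep-⊓ c z C (proj₁ Z) , ≤-<-trans small o
        where
        lower : order G z ≤ order G (c ⊔ z)
        lower = minimal (c ⊔ z) (isSep-⊔ c z C (proj₁ Z))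
          (≼-trans x≼z (≼-inv (⊓-lower₂ (inv G c) (inv G z))))
          (≼-inv (⊓-greatest (inv G c) (inv G z) (≼-inv c≼u) (≼-inv z≼u)))

        small : order G (c ⊓ z) ≤ order G c
        small = +-cancelʳ-≤ (order G z) _ _ (≤-trans (+-monoʳ-≤ (order G (c ⊓ z)) lower)
          (∣∩∣-submodular (proj₁ c) (proj₂ c) (proj₁ z) (proj₂ z)))

      -- Meeting with `z` leaves an unchanged side unchanged, and every member of the sweep is below
      -- its end `b`, hence below `u`.
      ⟶*-⊓ : ∀ {a b} → a ⟶* b → b ≼ u → a ⊓ z ⟶* b ⊓ z
      ⟶*-⊓ ε _ = ε
      ⟶*-⊓ {a} (_◅_ {j = c} r rs) b≼u = shift r ◅ ⟶*-⊓ rs b≼u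
        where
        c≼u = ≼-trans (⟶*⇒≼ rs) b≼u
        a≼u = ≼-trans (⟶⇒≼ r) c≼u
        shift : a ⟶ c → a ⊓ z ⟶ c ⊓ z
        shift (S , T , inj₁ (p , e)) = inS-⊓ _ S a≼u , inS-⊓ _ T c≼u , inj₁
          ((λ v∈ → let v∈₁ , v∈₂ = x∈p∩q⁻ _ _ v∈ in x∈p∩q⁺ (p v∈₁ , v∈₂)) , cong (_∪ proj₂ z) e)
        shift (S , T , inj₂ (e , q)) = inS-⊓ _ S a≼u , inS-⊓ _ T c≼u , inj₂
          (cong (_∩ proj₁ z) e , λ v∈ → x∈p∪q⁺ (Sum.map q id (x∈p∪q⁻ _ _ v∈)))

    -- Constant beyond the end of the sweep.
    nth : ∀ {s t} → s ⟶* t → ℕ → Sep G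
    nth {s} ε        _       = s
    nth {s} (_ ◅ rs) zero    = s
    nth     (_ ◅ rs) (suc i) = nth rs i

    sweepLength : ∀ {s t} → s ⟶* t → ℕ
    sweepLength ε        = 0
    sweepLength (_ ◅ rs) = suc (sweepLength rs)

    nth-first : ∀ {s t} (rs : s ⟶* t) → nth rs 0 ≡ s
    nth-first ε       = refl
    nth-first (_ ◅ _) = refl

    nth-last : ∀ {s t} (rs : s ⟶* t) → nth rs (sweepLength rs) ≡ t
    nth-last ε        = refl
    nth-last (_ ◅ rs) = nth-last rs

    nth-⟶ : ∀ {s t} (rs : s ⟶* t) → InS G k s → ∀ i → nth rs i ⟶ nth rs (suc i)
    nth-⟶ ε                S _       = S , S , inj₁ (⊆-refl , refl)
    nth-⟶ (r ◅ rs)         S zero    = subst (_ ⟶_) (sym (nth-first rs)) r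
    nth-⟶ (r ◅ rs)         S (suc i) = nth-⟶ rs (proj₁ (proj₂ r)) i

    nth-mono : ∀ {s t} (rs : s ⟶* t) → InS G k s → ∀ {i j} → i ≤ j → nth rs i ≼ nth rs j
    nth-mono rs S i≤j = go (≤⇒≤′ i≤j)
      where
      go : ∀ {i j} → i ≤′ j → nth rs i ≼ nth rs j
      go ≤′-refl       = ≼-refl
      go (≤′-step i≤j) = ≼-trans (go i≤j) (⟶⇒≼ (nth-⟶ rs S _))

    bag : Sep G → Subset n
    bag (A , B) = A ∩ B

    -- Since `u` is lost on the right, the step keeps the left side `A`, and `u` lies only in `A`
    -- afterwards. As `s′` is a separation, a neighbour `v` of `u` must lie in `A` as well.
    dropped⇒bag : ∀ {s s′} → s ⟶ s′ → ∀ u v → u ≡ v ⊎ Edge G u v → u ∈ proj₂ s → v ∈ proj₂ s → u ∉ proj₂ s′ →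
      u ∈ bag s × v ∈ bag s
    dropped⇒bag (_ , _ , inj₁ (_ , refl)) u v uv u∈ v∈ u∉ = contradiction u∈ u∉
    dropped⇒bag {A , B} (_ , ((cover , noEdge) , _) , inj₂ (refl , _)) u v uv u∈ v∈ u∉ =
      x∈p∩q⁺ (u∈A , u∈) , x∈p∩q⁺ (decidable-stable (v ∈? A) (v∉A⇒absurd uv) , v∈)
      where
      u∈A : u ∈ A
      u∈A = fromInj₁ (λ u∈′ → contradiction u∈′ u∉) (cover u)
      v∉A⇒absurd : u ≡ v ⊎ Edge G u v → v ∉ A → Absurd
      v∉A⇒absurd (inj₁ refl) v∉A = v∉A u∈A
      v∉A⇒absurd (inj₂ e)    v∉A =
        noEdge u v e u∈A u∉ (fromInj₂ (λ v∈A → contradiction v∈A v∉A) (cover v)) v∉A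

    -- The first separation of the sweep whose successor loses u or v on the right-hand side has both in its bag.
    covering : ∀ {s t} (rs : s ⟶* t) u v → u ≡ v ⊎ Edge G u v →
      u ∈ proj₂ s → v ∈ proj₂ s → u ∉ proj₂ t →
      ∃ λ i → i ≤ sweepLength rs × u ∈ bag (nth rs i) × v ∈ bag (nth rs i)
    covering ε u v _ u∈ _ u∉ = contradiction u∈ u∉
    covering {s} (_◅_ {j = s′} r rs) u v uv u∈ v∈ u∉ with u ∈? proj₂ s′ | v ∈? proj₂ s′
    ... | yes u∈′ | yes v∈′ =
      let i , i≤ , u∈i , v∈i = covering rs u v uv u∈′ v∈′ u∉ in suc i , s≤s i≤ , u∈i , v∈i
    ... | no u∉′ | _     = 0 , z≤n , dropped⇒bag r u v uv u∈ v∈ u∉′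
    ... | yes _ | no v∉′ = 0 , z≤n ,
      Product.swap (dropped⇒bag r v u (Sum.map sym (trans (Graph.sym G v u)) uv) v∈ u∈ v∉′)

    -- Tangles and S_k-trees

    -- Both sides of a separation equal to its inverse are V, so its order is `n`.
    nondegenerate : k ≤ n → ∀ s → InS G k s → s ≢ inv G s
    nondegenerate k≤n (A , B) ((cover , _) , small) e = ≤⇒≯ k≤n (≤-<-trans
      (subst (_≤ ∣ A ∩ B ∣) (∣⊤∣≡n n) (p⊆q⇒∣p∣≤∣q∣ {p = ⊤} λ {v} _ → both (cong proj₁ e) v)) small)
      where
      both : A ≡ B → ∀ v → v ∈ A ∩ B
      both refl v = x∈p∩q⁺ ([ id , id ]′ (cover v) , [ id , id ]′ (cover v))

    module _ (k≤n : k ≤ n) where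

      F2-single : ∀ s → InS G k s → ∣ proj₂ s ∣ < k → InF2 G k (s ∷ [])
      F2-single s S small =
        ([] ∷ []) , s≤s z≤n , (proj₁ S ∷ []) , ((nondegenerate k≤n s S ∷ []) , star) ,
        subst (λ p → ∣ p ∣ < k) (sym (∩-identityʳ (proj₂ s))) small
        where
        star : ∀ t u → t ∈ₗ s ∷ [] → u ∈ₗ s ∷ [] → t ≢ u → t ≼ inv G u
        star _ _ (here refl) (here refl) t≢u = contradiction refl t≢u

      F2-pair : ∀ s t → s ≢ t → InS G k s → InS G k t → s ≼ inv G t → ∣ proj₂ s ∩ proj₂ t ∣ < k →
        InF2 G k (s ∷ t ∷ [])
      F2-pair s t s≢t S T s≼t⁻ small =
        ((s≢t ∷ []) ∷ [] ∷ []) , s≤s (s≤s z≤n) , (proj₁ S ∷ proj₁ T ∷ []) ,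
        ((nondegenerate k≤n s S ∷ nondegenerate k≤n t T ∷ []) , star) ,
        subst (λ p → ∣ proj₂ s ∩ p ∣ < k) (sym (∩-identityʳ (proj₂ t))) small
        where
        star : ∀ u v → u ∈ₗ s ∷ t ∷ [] → v ∈ₗ s ∷ t ∷ [] → u ≢ v → u ≼ inv G v
        star _ _ (here refl)         (here refl)         u≢v = contradiction refl u≢v
        star _ _ (here refl)         (there (here refl)) _   = s≼t⁻
        star _ _ (there (here refl)) (here refl)         _   = ≼-inv s≼t⁻
        star _ _ (there (here refl)) (there (here refl)) u≢v = contradiction refl u≢v

    -- The intersection of the empty star is V. For `n < k` this star excludes every tangle and
    -- labels the one-node tree, so elsewhere `k ≤ n` may be assumed.
    F2-empty : n < k → InF2 G k []
    F2-empty n<k = [] , z≤n , [] , ([] , λ _ _ ()) , subst (_< k) (sym (∣⊤∣≡n n)) n<k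

    singletonTree : n < k → SkTree G k
    singletonTree n<k = record
      { T = pathTree 0
      ; α = λ _ _ → bot
      ; α-in = λ { zero zero () }
      ; α-inv = λ { zero zero () }
      ; α-star = λ { zero → [] , (λ s → (λ ()) , λ { (zero , () , _) }) , F2-empty n<k }
      }

    tangle⇒k≤n : ∀ {O} → IsTangle G k O → k ≤ n
    tangle⇒k≤n (_ , _ , avoid) = ≮⇒≥ λ n<k → avoid [] (F2-empty n<k) []

    tangle⇒¬skTree : HasTangle G k → ¬ SkTree G k
    tangle⇒¬skTree (O , tangle@((O⇒inS , orient) , _ , avoid)) tree =
      tree-turns-back T (λ t → proj₁ (exit t)) (λ t → trans (symT t _) (proj₁ (proj₂ (exit t)))) forward
      where
      open SkTree tree
      open Tree T

      -- Although `O` is an arbitrary predicate, it contains exactly one of `s` and `inv G s`, so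
      -- membership is decidable on S_k. This makes the search for an exit constructive.
      O? : ∀ s → InS G k s → Dec (O s)
      O? s S with proj₁ (orient s S)
      ... | inj₁ Os  = yes Os
      ... | inj₂ Os⁻ = no λ Os → nondegenerate (tangle⇒k≤n tangle) s S (proj₂ (orient s S) Os Os⁻)

      Inward : Fin m → Fin m → Set
      Inward t x = adjT x t ≡ true → O (α x t)

      inward? : ∀ t x → Dec (Inward t x)
      inward? t x with adjT x t ≟ᵇ true
      ... | no ¬e = yes λ e → contradiction e ¬e
      ... | yes e = map′ (λ Os _ → Os) (λ f → f e) (O? (α x t) (α-in x t e))

      exit : ∀ t → ∃ λ x → adjT x t ≡ true × ¬ O (α x t)
      exit t with Fin.¬∀⟶∃¬ m (Inward t) (inward? t) no-sink
        where
        no-sink : ¬ (∀ x → Inward t x)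
        no-sink inward = let σ , members , F2 = α-star t in
          avoid σ F2 (All.tabulate λ {s} s∈ → let x , e , eq = proj₁ (members s) s∈ in subst O eq (inward x e))
      ... | x , outward = x , decidable-stable (adjT x t ≟ᵇ true) (λ ¬e → outward λ e → contradiction e ¬e)
                            , λ Os → outward λ _ → Os

      -- An edge along which both of its ends exit would have neither of its two labels in `O`.
      forward : ∀ t → proj₁ (exit (proj₁ (exit t))) ≢ t
      forward t back =
        let x , e , ¬O = exit t
            _ , _ , ¬O′ = exit x
        in [ ¬O , (λ O⁻ → subst (λ y → ¬ O (α y x)) back ¬O′ (subst O (sym (α-inv x t e)) O⁻)) ]′
             (proj₁ (orient (α x t) (α-in x t e)))

    -- Blockages

    hasOuterNeighbour : Subset n → V G → Bool
    hasOuterNeighbour X v = any (λ w → adj v w ∧ not (lookup X w)) (allFin n)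

    ∈-∂⁻ : ∀ {X v} → v ∈ ∂ G X → v ∈ X × ∃ λ w → Edge G v w × w ∉ X
    ∈-∂⁻ {X} {v} v∈
      with lookup X v in v∈X | hasOuterNeighbour X v in outer
         | trans (sym (lookup∘tabulate (λ u → lookup X u ∧ hasOuterNeighbour X u) v)) ([]=⇒lookup v∈)
    ... | true | true | refl
      with w , e ← Any.satisfied (any⁻ (λ w → adj v w ∧ not (lookup X w)) (allFin n) (Equivalence.from T-≡ outer))
      with adj v w in vw | lookup X w in w∉X
    ... | true | false =
      lookup⇒[]= v X v∈X , w , vw , λ w∈ → contradiction (trans (sym w∉X) ([]=⇒lookup w∈)) λ ()

    ∈-∂⁺ : ∀ {X v} w → v ∈ X → Edge G v w → w ∉ X → v ∈ ∂ G X
    ∈-∂⁺ {X} {v} w v∈ vw w∉ = lookup⇒[]= v _ (trans (lookup∘tabulate _ v) (cong₂ _∧_ ([]=⇒lookup v∈)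
      (Equivalence.to T-≡ (any⁺ _ (lose (∈-allFin w)
        (Equivalence.from T-≡ (cong₂ (λ x y → x ∧ not y) vw ∉⇒false)))))))
      where
      ∉⇒false : lookup X w ≡ false
      ∉⇒false = ¬-not λ e → w∉ (lookup⇒[]= w X e)

    -- A boundary vertex outside `B` would send an edge across the separation.
    ∂⊆bag : ∀ {A B} → IsSep G (A , B) → ∂ G A ⊆ A ∩ B
    ∂⊆bag {A} {B} (cover , noEdge) {v} v∈ =
      let v∈A , w , e , w∉A = ∈-∂⁻ v∈
      in x∈p∩q⁺ (v∈A , decidable-stable (v ∈? B) λ v∉B →
           noEdge v w e v∈A v∉B (fromInj₂ (λ w∈A → contradiction w∈A w∉A) (cover w)) w∉A)

    ∣∂∣≤order : ∀ {A B} → IsSep G (A , B) → ∣ ∂ G A ∣ ≤ order G (A , B)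
    ∣∂∣≤order S = p⊆q⇒∣p∣≤∣q∣ (∂⊆bag S)

    blockage⇒tangle : HasBlockage G k → HasTangle G k
    blockage⇒tangle (𝓑 , thin , down , choice) =
      O , ((λ s → proj₁) , orient) , consistent , avoid
      where
      O : Sep G → Set
      O s = InS G k s × 𝓑 (proj₁ s)

      orient : ∀ s → InS G k s → (O s ⊎ O (inv G s)) × (O s → O (inv G s) → s ≡ inv G s)
      orient s S = let some , notBoth = choice (proj₁ s) (proj₂ s) S in
        Sum.map (S ,_) (inS-inv S ,_) some , λ (_ , 𝓑A) (_ , 𝓑B) → contradiction (𝓑A , 𝓑B) notBoth

      consistent : IsConsistent G k O
      consistent s t S _ _ ((A⊆C , _) , _) (_ , 𝓑B) (_ , 𝓑C) = proj₂ (choice (proj₁ s) (proj₂ s) S)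
        (down (proj₁ t) (proj₁ s) 𝓑C A⊆C (≤-<-trans (∣∂∣≤order (proj₁ S)) (proj₂ S)) , 𝓑B)

      inS-⊤ : ∀ B → ∣ B ∩ ⊤ ∣ < k → InS G k (B , ⊤)
      inS-⊤ B small = ((λ _ → inj₂ ∈⊤) , λ _ _ _ _ u∉⊤ → contradiction ∈⊤ u∉⊤) , small

      avoid : ∀ σ → InF2 G k σ → All O σ → Absurd
      -- If V has fewer than `k` vertices, then (V , V) is in S_k, and exactly one of its two equal
      -- sides would have to lie in `𝓑`.
      avoid [] (_ , _ , _ , _ , small) []
        with some , notBoth ← choice ⊤ ⊤ (inS-⊤ ⊤
          (subst (λ (p : Subset n) → ∣ p ∣ < k) (sym (∩-idem ⊤)) small))
        with some
      ... | inj₁ 𝓑⊤ = notBoth (𝓑⊤ , 𝓑⊤)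
      ... | inj₂ 𝓑⊤ = notBoth (𝓑⊤ , 𝓑⊤)
      -- The pair (B , V) is in S_k, so `B` or V lies in `𝓑`. By (B2) it is `B` in either case,
      -- against `A`.
      avoid ((A , B) ∷ []) (_ , _ , _ , _ , small) ((S , 𝓑A) ∷ []) =
        proj₂ (choice A B S) (𝓑A , [ id , (λ 𝓑⊤ → down ⊤ B 𝓑⊤ (⊆-max B) (≤-<-trans (∣∂∣≤order (proj₁ B⊤)) small)) ]′
          (proj₁ (choice B ⊤ B⊤)))
        where
        B⊤ : InS G k (B , ⊤)
        B⊤ = inS-⊤ B small
      -- The middle separation (D , B) has the intersection of the star as its separator, so (B3)
      -- puts `D` or `B` into `𝓑`, against `C` or `A`.
      avoid ((A , B) ∷ (C , D) ∷ []) ((s≢t ∷ []) ∷ _ , _ , _ , (_ , star) , small) ((S , 𝓑A) ∷ (T , 𝓑C) ∷ [])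
        with proj₁ (choice D B (isSep-middle (A , B) (D , C) s≼t (proj₁ S) (isSep-inv (proj₁ T)) ,
               subst (λ p → ∣ p ∣ < k) (trans (cong (B ∩_) (∩-identityʳ D)) (∩-comm B D)) small))
        where
        s≼t = star (A , B) (C , D) (here refl) (there (here refl)) s≢t
      ... | inj₁ 𝓑D = proj₂ (choice C D T) (𝓑C , 𝓑D)
      ... | inj₂ 𝓑B = proj₂ (choice A B S) (𝓑A , 𝓑B)
      avoid (_ ∷ _ ∷ _ ∷ _) (_ , s≤s (s≤s ()) , _)

    -- The largest separation with left-hand side X.
    sat : Subset n → Sep G
    sat X = X , ∁ X ∪ ∂ G X

    sat-isSep : ∀ X → IsSep G (sat X)
    sat-isSep X = cover , noEdge
      where
      cover : ∀ v → v ∈ X ⊎ v ∈ ∁ X ∪ ∂ G X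
      cover v with v ∈? X
      ... | yes v∈X = inj₁ v∈X
      ... | no v∉X  = inj₂ (x∈p∪q⁺ (inj₁ (x∉p⇒x∈∁p v∉X)))
      noEdge : ∀ u v → Edge G u v → u ∈ X → u ∉ ∁ X ∪ ∂ G X → v ∈ ∁ X ∪ ∂ G X → v ∉ X → Absurd
      noEdge u v e u∈X u∉ _ v∉X = u∉ (x∈p∪q⁺ (inj₂ (∈-∂⁺ v u∈X e v∉X)))

    sat-inS : ∀ {X} → ∣ ∂ G X ∣ < k → InS G k (sat X)
    sat-inS {X} small = sat-isSep X , ≤-<-trans (p⊆q⇒∣p∣≤∣q∣ λ v∈ →
      let v∈X , v∈sat = x∈p∩q⁻ X _ v∈
      in [ (λ v∈∁X → contradiction v∈X (x∈∁p⇒x∉p v∈∁X)) , id ]′ (x∈p∪q⁻ (∁ X) _ v∈sat)) small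

    ≼-sat : ∀ s → IsSep G s → s ≼ sat (proj₁ s)
    ≼-sat (A , B) S@(cover , _) = ⊆-refl , λ {v} v∈ →
      [ (λ v∈∁A → fromInj₂ (λ v∈A → contradiction v∈A (x∈∁p⇒x∉p v∈∁A)) (cover v))
      , (λ v∈∂ → proj₂ (x∈p∩q⁻ A B (∂⊆bag S v∈∂))) ]′ (x∈p∪q⁻ (∁ A) _ v∈)

    sat-mono : ∀ {X Y} → X ⊆ Y → sat X ≼ sat Y
    sat-mono {X} {Y} X⊆Y = X⊆Y , λ {v} v∈ → [ (λ v∈∁Y → outside-X (λ v∈X → x∈∁p⇒x∉p v∈∁Y (X⊆Y v∈X))) ,
        (λ v∈∂Y → boundary v∈∂Y) ]′ (x∈p∪q⁻ (∁ Y) _ v∈)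
      where
      outside-X : ∀ {v} → v ∉ X → v ∈ ∁ X ∪ ∂ G X
      outside-X v∉X = x∈p∪q⁺ (inj₁ (x∉p⇒x∈∁p v∉X))
      boundary : ∀ {v} → v ∈ ∂ G Y → v ∈ ∁ X ∪ ∂ G X
      boundary {v} v∈∂Y with v ∈? X | ∈-∂⁻ v∈∂Y
      ... | no v∉X  | _                = outside-X v∉X
      ... | yes v∈X | _ , w , e , w∉Y = x∈p∪q⁺ (inj₂ (∈-∂⁺ w v∈X e (λ w∈X → w∉Y (X⊆Y w∈X))))

    tangle⇒blockage : HasTangle G k → HasBlockage G k
    tangle⇒blockage (O , tangle@((O⇒inS , orient) , consistent , avoid)) =
      (λ X → ∣ ∂ G X ∣ < k × O (sat X)) , (λ _ → proj₁) ,
      (λ X Y (X-small , OX) Y⊆X Y-small → Y-small , O-down (sat-inS Y-small) (sat-inS X-small) (sat-mono Y⊆X) OX) ,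
      λ A B S →
        Sum.map (λ O-AB → small S , O-sat S O-AB) (λ O-BA → small (inS-inv S) , O-sat (inS-inv S) O-BA)
          (proj₁ (orient (A , B) S)) ,
        -- If `O` contains (A , B), it contains the smaller separation `inv G (sat B)`, so `sat B`
        -- cannot be in `O`. The other orientation is symmetric.
        λ ((A-small , O-A) , (B-small , O-B)) →
          [ (λ O-AB → asym (sat-inS B-small) O-B
              (O-down (inS-inv (sat-inS B-small)) S (≼-inv (≼-sat (B , A) (isSep-inv (proj₁ S)))) O-AB))
          , (λ O-BA → asym (sat-inS A-small) O-A
              (O-down (inS-inv (sat-inS A-small)) (inS-inv S) (≼-inv (≼-sat (A , B) (proj₁ S))) O-BA))
          ]′ (proj₁ (orient (A , B) S))
      where
      k≤n = tangle⇒k≤n tangle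

      small : ∀ {s} → InS G k s → ∣ ∂ G (proj₁ s) ∣ < k
      small (S , o) = ≤-<-trans (∣∂∣≤order S) o

      asym : ∀ {s} → InS G k s → O s → ¬ O (inv G s)
      asym {s} S Os Os⁻ = nondegenerate k≤n s S (proj₂ (orient s S) Os Os⁻)

      -- Consistency does not cover the case t = inv s, which is excluded by the star { inv s }.
      O-down : ∀ {s t} → InS G k s → InS G k t → s ≼ t → O t → O s
      O-down {s} {t} S T s≼t Ot with proj₁ (orient s S) | s ≟ₛ t | s ≟ₛ inv G t
      ... | inj₁ Os | _        | _        = Os
      ... | inj₂ _  | yes refl | _        = Ot
      ... | inj₂ _  | no _     | yes refl = contradiction (Ot ∷ [])
              (avoid (t ∷ []) (F2-single k≤n t T (≤-<-trans
                (p⊆q⇒∣p∣≤∣q∣ (λ v∈ → x∈p∩q⁺ (proj₁ s≼t v∈ , v∈))) (proj₂ T))))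
      ... | inj₂ O⁻ | no s≢t   | no s≢t⁻  = contradiction Ot (consistent s t S T
              (λ { (inj₁ (e , e′)) → s≢t (cong₂ _,_ e e′) ; (inj₂ (e , e′)) → s≢t⁻ (cong₂ _,_ e e′) })
              (s≼t , s≢t) O⁻)

      -- The star formed by `s` and the inverse of its saturation has right-hand sides `B` and `A`,
      -- so its intersection is the separator of `s`, and `O` must avoid it.
      O-sat : ∀ {s} → InS G k s → O s → O (sat (proj₁ s))
      O-sat {s} S Os with proj₁ (orient (sat (proj₁ s)) (sat-inS (small S)))
      ... | inj₁ Oˢ = Oˢ
      ... | inj₂ O⁻ = contradiction (Os ∷ O⁻ ∷ []) (avoid (s ∷ inv G (sat (proj₁ s)) ∷ [])
              (F2-pair k≤n s (inv G (sat (proj₁ s)))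
                (λ e → nondegenerate k≤n s S (cong₂ _,_ (sym (cong proj₂ e)) (cong proj₂ e))) S
                (inS-inv (sat-inS (small S))) (≼-sat s (proj₁ S))
                (subst (λ p → ∣ p ∣ < k) (∩-comm (proj₁ s) (proj₂ s)) (proj₂ S))))

    module _ (0<k : 0 < k) where

      -- Extending partial tangles

      bot-inS : InS G k bot
      bot-inS = bot-isSep , subst (_< k) (sym order-bot) 0<k

      -- A complete such set is a tangle: a star { s , t } in F_k^(2) gives a sweep from s to inv t.
      record Partial : Set₁ where
        field
          P     : Sep G → Set
          P?    : Decidable P
          P⇒inS : ∀ {s} → P s → InS G k s
          P-bot : P bot
          down  : ∀ {s t} → P t → InS G k s → s ≼ t → P s
          free  : ∀ {s t} → P s → P t → ¬ (s ⟶* inv G t)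

      _⊑_ : Partial → Partial → Set
      X ⊑ Y = ∀ s → Partial.P X s → Partial.P Y s

      Decided : Partial → Sep G → Set
      Decided X s = InS G k s → Partial.P X s ⊎ Partial.P X (inv G s)

      module _ (X : Partial) where
        open Partial X

        -- A separation of least order between x and u is linked to both, so both sweeps can be shifted to meet there.
        link : ∀ {p x u q} → P p → p ⟶* u → InS G k x → x ≼ u → InS G k q → x ⟶* inv G q →
          (∀ {p′ q′} → P p′ → InS G k q′ → q′ ≼ q → ¬ (p′ ⟶* inv G q′)) → Absurd
        link {p} {x} {u} {q} Pp p⟶u X∈ x≼u Q x⟶q κ = go x X∈ ≼-refl x≼u (<-wellFounded _)
          where
          go : ∀ z → InS G k z → x ≼ z → z ≼ u → Acc _<_ (order G z) → Absurd
          go z Z x≼z z≼u (acc smaller) =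
            κ (down Pp (Low.inS-⊓ p (P⇒inS Pp) (⟶*⇒≼ p⟶u)) (⊓-lower₁ p z))
              (High.inS-⊓ q Q (⟶*⇒≼ (⟶*-inv x⟶q))) (⊓-lower₁ q (inv G z))
              (p⟶z ◅◅ z⟶q)
            where
            -- A separation `w` of smaller order would give the contradiction by recursion, so `z`
            -- may be assumed to have least order.
            minimal : ∀ w → IsSep G w → x ≼ w → w ≼ u → order G z ≤ order G w
            minimal w W x≼w w≼u = ≮⇒≥ λ w<z →
              go w (W , <-trans w<z (proj₂ Z)) x≼w w≼u (smaller w<z)

            minimal′ : ∀ w → IsSep G w → inv G u ≼ w → w ≼ inv G x → order G (inv G z) ≤ order G w
            minimal′ w W u≼w w≼x = subst₂ _≤_ (sym (order-inv z)) (order-inv w)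
              (minimal (inv G w) (isSep-inv W) (≼-inv w≼x) (≼-inv u≼w))

            -- `Low` meets the sweep from `p` to `u` with `z`, so that it ends in `u ⊓ z = z`.
            -- `High` does the same with `inv G z` to the reversed sweep from `q`, whose reversal
            -- then starts in `z`.
            module Low  = Shift Z x≼z z≼u minimal
            module High = Shift (inS-inv Z) (≼-inv z≼u) (≼-inv x≼z) minimal′

            p⟶z : p ⊓ z ⟶* z
            p⟶z = subst (p ⊓ z ⟶*_)
              (≼-antisym (⊓-lower₂ u z) (⊓-greatest u z z≼u ≼-refl)) (Low.⟶*-⊓ p⟶u ≼-refl)

            z⟶q : z ⟶* inv G (q ⊓ inv G z)
            z⟶q = ⟶*-inv (subst (q ⊓ inv G z ⟶*_)
              (≼-antisym (⊓-lower₂ (inv G x) (inv G z)) (⊓-greatest (inv G x) (inv G z) (≼-inv x≼z) ≼-refl))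
              (High.⟶*-⊓ (⟶*-inv x⟶q) ≼-refl))

        -- Here `u` is forced, since choosing `inv G u` would violate `free` by the given sweep. All
        -- of S_k below `u` is added with it to keep the set closed downwards.
        extend-below : ∀ {p u} → P p → p ⟶* u → Partial
        extend-below {p} {u} Pp p⟶u = record
          { P     = P′
          ; P?    = λ s → P? s ⊎-dec (inS? s ×-dec (s ≼? u))
          ; P⇒inS = [ P⇒inS , proj₁ ]′
          ; P-bot = inj₁ P-bot
          ; down  = down′
          ; free  = free′
          }
          where
          P′ : Sep G → Set
          P′ s = P s ⊎ (InS G k s × s ≼ u)

          down′ : ∀ {s t} → P′ t → InS G k s → s ≼ t → P′ s
          down′ (inj₁ Pt)        S s≼t = inj₁ (down Pt S s≼t)
          down′ (inj₂ (_ , t≼u)) S s≼t = inj₂ (S , ≼-trans s≼t t≼u)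

          free-below : ∀ {s t} → InS G k s → s ≼ u → P t → ¬ (s ⟶* inv G t)
          free-below S s≼u Pt r = link Pp p⟶u S s≼u (P⇒inS Pt) r
            λ Pp′ Q′ q′≼t → free Pp′ (down Pt Q′ q′≼t)

          free′ : ∀ {s t} → P′ s → P′ t → ¬ (s ⟶* inv G t)
          free′ (inj₁ Ps)        (inj₁ Pt)        r = free Ps Pt r
          free′ (inj₂ (S , s≼u)) (inj₁ Pt)        r = free-below S s≼u Pt r
          free′ (inj₁ Ps)        (inj₂ (T , t≼u)) r = free-below T t≼u Ps (⟶*-inv r)
          -- Both ends are new. Linking moves the start into `P` and the end to the inverse of a
          -- separation below `t`, hence below `u`, which leaves the case of one new end.
          free′ (inj₂ (S , s≼u)) (inj₂ (T , t≼u)) r = link Pp p⟶u S s≼u T r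
            λ Pp′ Q′ q′≼t r′ → free-below Q′ (≼-trans q′≼t t≼u) Pp′ (⟶*-inv r′)

        module _ {s} (S : InS G k s) (unforced : ∀ {p} → P p → ¬ (p ⟶* inv G s))
          (below : ∀ t → t ≼ s → t ≢ s → Decided X t) where

          extend-minimal : Partial
          extend-minimal = record
            { P     = P′
            ; P?    = λ t → P? t ⊎-dec (t ≟ₛ s)
            ; P⇒inS = [ P⇒inS , (λ { refl → S }) ]′
            ; P-bot = inj₁ P-bot
            ; down  = down′
            ; free  = free′
            }
            where
            P′ : Sep G → Set
            P′ t = P t ⊎ (t ≡ s)

            down′ : ∀ {r t} → P′ t → InS G k r → r ≼ t → P′ r
            down′ (inj₁ Pt) R r≼t = inj₁ (down Pt R r≼t)
            down′ {r} (inj₂ refl) R r≼s with r ≟ₛ s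
            ... | yes r≡s = inj₂ r≡s
            ... | no r≢s with below r r≼s r≢s R
            ...   | inj₁ Pr  = inj₁ Pr
            -- If `inv G r` were chosen, so would be the smaller `inv G s`, and the trivial sweep
            -- would force it.
            ...   | inj₂ Pr⁻ = contradiction ε (unforced (down Pr⁻ (inS-inv S) (≼-inv r≼s)))

            free′ : ∀ {r t} → P′ r → P′ t → ¬ (r ⟶* inv G t)
            free′ (inj₁ Pr)   (inj₁ Pt)   w = free Pr Pt w
            free′ (inj₁ Pr)   (inj₂ refl) w = unforced Pr w
            free′ (inj₂ refl) (inj₁ Pt)   w = unforced Pt (⟶*-inv w)
            -- A sweep from `s` to its inverse makes the left side of `s` a subset of the right
            -- side, so it has fewer than `k` elements. Then a sweep leads from `bot` to `s` and on
            -- to `inv G s`, which would be forced.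
            free′ (inj₂ refl) (inj₂ refl) w = unforced P-bot (bot⟶*s ◅◅ w)
              where
              s≼s⁻ = ⟶*⇒≼ w
              bot⟶*s : bot ⟶* s
              bot⟶*s = ⟶*-bag bot s bot-min bot-inS S
                (≤-<-trans (p⊆q⇒∣p∣≤∣q∣ (λ v∈ → let v∈A = proj₂ (x∈p∩q⁻ ⊤ (proj₁ s) v∈)
                                                in x∈p∩q⁺ (v∈A , proj₁ s≼s⁻ v∈A))) (proj₂ S))

        decide : ∀ s → (∀ t → t ≼ s → t ≢ s → Decided X t) → ∃ λ Y → X ⊑ Y × Decided Y s
        decide s below with inS? s
        ... | no ¬S = X , (λ _ Pt → Pt) , λ S → contradiction S ¬S
        -- Whether some chosen element forces `inv G s` is settled by exhaustive search, using the
        -- decidability of `P` and of sweeps.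
        ... | yes S with anySubset? (λ A → anySubset? (λ B → P? (A , B) ×-dec ((A , B) ⟶*? inv G s)))
        ...   | yes (A , B , Pp , r) = extend-below Pp r , (λ _ → inj₁) , λ _ → inj₂ (inj₂ (inS-inv S , ≼-refl))
        ...   | no ∄p = extend-minimal S (λ Pp r → ∄p (_ , _ , Pp , r)) below ,
                (λ _ → inj₁) , λ _ → inj₁ (inj₂ refl)

      ⊑-refl : ∀ {X} → X ⊑ X
      ⊑-refl _ Ps = Ps

      ⊑-trans : ∀ {X Y Z} → X ⊑ Y → Y ⊑ Z → X ⊑ Z
      ⊑-trans f g s Ps = g s (f s Ps)

      decided-mono : ∀ {X Y} → X ⊑ Y → ∀ {s} → Decided X s → Decided Y s
      decided-mono X⊑Y d S = Sum.map (X⊑Y _) (X⊑Y _) (d S)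

      -- Separations are processed by increasing A and, for fixed A, by decreasing B.
      decided-below : ∀ X A B → (∀ A′ → A′ ⊂ A → ∀ B → Decided X (A′ , ∁ B)) →
        (∀ B′ → B′ ⊂ B → Decided X (A , ∁ B′)) →
        ∀ t → t ≼ (A , ∁ B) → t ≢ (A , ∁ B) → Decided X t
      decided-below X A B left above (C , D) (C⊆A , B⁻⊆D) t≢
        with ⊆⇒⊂⊎≡ C⊆A | ⊆⇒⊂⊎≡ {p = ∁ D} {B} (λ v∈ → x∉∁p⇒x∈p (λ v∈B⁻ → x∈∁p⇒x∉p v∈ (B⁻⊆D v∈B⁻)))
      ... | inj₁ C⊂A  | _          = subst (λ D → Decided X (C , D)) (∁-involutive D) (left C C⊂A (∁ D))
      ... | inj₂ refl | inj₁ D⁻⊂B  = subst (λ D → Decided X (C , D)) (∁-involutive D) (above (∁ D) D⁻⊂B)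
      ... | inj₂ refl | inj₂ refl  = contradiction (cong (C ,_) (sym (∁-involutive D))) t≢

      -- Deciding a separation presupposes decisions for all smaller left-hand sides, so the states
      -- carry these along. The complement turns increasing `B` into decreasing right-hand sides.
      complete-column : ∀ X A → (∀ A′ → A′ ⊂ A → ∀ B → Decided X (A′ , ∁ B)) →
        ∃ λ Y → X ⊑ Y × (∀ B → Decided Y (A , ∁ B))
      complete-column X A left
        with (Y , _) , X⊑Y , d ← saturate
          {St = ∃ λ Y → ∀ A′ → A′ ⊂ A → ∀ B → Decided Y (A′ , ∁ B)} (λ (X , _) (Y , _) → X ⊑ Y)
          (λ {X} → ⊑-refl {proj₁ X}) (λ {X} {Y} {Z} → ⊑-trans {proj₁ X} {proj₁ Y} {proj₁ Z}) n
          (λ (Y , _) B → Decided Y (A , ∁ B))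
          (λ {X} {Y} B X⊑Y → decided-mono {proj₁ X} {proj₁ Y} X⊑Y)
          (λ (X , left) B above →
            let Y , X⊑Y , d = decide X (A , ∁ B) (decided-below X A B left above)
            in (Y , λ A′ A′⊂A B → decided-mono {X} {Y} X⊑Y (left A′ A′⊂A B)) , X⊑Y , d)
          (X , left)
        = Y , X⊑Y , d

      complete : ∀ X → ∃ λ Y → X ⊑ Y × (∀ s → Decided Y s)
      complete X
        with Y , X⊑Y , d ← saturate _⊑_ (λ {X} → ⊑-refl {X}) (λ {X} {Y} {Z} → ⊑-trans {X} {Y} {Z}) n
          (λ Y A → ∀ B → Decided Y (A , ∁ B))
          (λ {X} {Y} A X⊑Y d B → decided-mono {X} {Y} X⊑Y (d B)) complete-column X
        = Y , X⊑Y , λ (A , B) → subst (λ B → Decided Y (A , B)) (∁-involutive B) (d A (∁ B))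

      unswept⇒tangle : ¬ (bot ⟶* inv G bot) → HasTangle G k
      unswept⇒tangle unswept
        with Y , _ , decided ← complete (record
          { P     = _≡ bot
          ; P?    = _≟ₛ bot
          ; P⇒inS = λ { refl → bot-inS }
          ; P-bot = refl
          ; down  = λ { refl _ s≼bot → ≼-antisym s≼bot bot-min }
          ; free  = λ { refl refl → unswept }
          })
        = P , ((λ s → P⇒inS) , λ s S → decided s S , λ Ps Ps⁻ → contradiction ε (free Ps Ps⁻))
            , (λ s t S T _ (s≼t , _) Ps⁻ Pt → free (down Pt S s≼t) Ps⁻ ε)
            , avoid
        where
        open Partial Y
        avoid : ∀ σ → InF2 G k σ → All P σ → Absurd
        -- Stars with fewer than two elements are filled up with `bot`, whose right-hand side V does
        -- not change the intersection.
        avoid [] (_ , _ , _ , _ , small) [] = free P-bot P-bot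
          (⟶*-bag bot (inv G bot) bot-min bot-inS (inS-inv bot-inS)
            (subst (λ (p : Subset n) → ∣ p ∣ < k) (sym (∩-idem ⊤)) small))
        avoid (s ∷ []) (_ , _ , _ , _ , small) (Ps ∷ []) = free P-bot Ps
          (⟶*-bag bot (inv G s) bot-min bot-inS (inS-inv (P⇒inS Ps))
            (subst (λ p → ∣ p ∣ < k) (∩-comm (proj₂ s) ⊤) small))
        avoid (s ∷ t ∷ []) ((s≢t ∷ []) ∷ _ , _ , _ , (_ , star) , small) (Ps ∷ Pt ∷ []) = free Ps Pt
          (⟶*-bag s (inv G t) (star s t (here refl) (there (here refl)) s≢t) (P⇒inS Ps) (inS-inv (P⇒inS Pt))
            (subst (λ p → ∣ proj₂ s ∩ p ∣ < k) (∩-identityʳ (proj₂ t)) small))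
        avoid (_ ∷ _ ∷ _ ∷ _) (_ , s≤s (s≤s ()) , _)

      -- Path-decompositions

      sweep⇒pathDecomposition : 1 ≤ n → bot ⟶* inv G bot → ∃ λ D → width G D < k ∸ 1
      sweep⇒pathDecomposition 1≤n rs =
        D , bigMax-< (λ i → ∣ PathDecomposition.W D i ∣ ∸ 1) 0<k∸1 (λ i → pred-<-pred 1<k (small (toℕ i)))
        where
        bags : ℕ → Subset n
        bags i = bag (nth rs i)

        small : ∀ i → ∣ bags i ∣ < k
        small i = proj₂ (proj₁ (nth-⟶ rs bot-inS i))

        covers : ∀ u v → u ≡ v ⊎ Edge G u v →
          ∃ λ (i : Fin (suc (sweepLength rs))) → u ∈ bags (toℕ i) × v ∈ bags (toℕ i)
        covers u v uv with i , i≤ , uv∈ ← covering rs u v uv ∈⊤ ∈⊤ ∉⊥ =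
          fromℕ< (s≤s i≤) , subst (λ j → u ∈ bags j × v ∈ bags j) (sym (Fin.toℕ-fromℕ< (s≤s i≤))) uv∈

        D : PathDecomposition G
        D = record
          { r       = suc (sweepLength rs)
          ; W       = λ i → bags (toℕ i)
          ; coversV = λ v → let i , v∈ , _ = covers v v (inj₁ refl) in i , v∈
          ; coversE = λ u v e → covers u v (inj₂ e)
          -- Left-hand sides grow and right-hand sides shrink along the sweep, so the left side
          -- comes from bag `i` and the right side from bag `l`.
          ; interp  = λ i j l i≤j j≤l v∈ →
              let v∈i , v∈l = x∈p∩q⁻ (bags (toℕ i)) _ v∈
              in x∈p∩q⁺ (proj₁ (nth-mono rs bot-inS i≤j) (proj₁ (x∈p∩q⁻ _ _ v∈i))
                       , proj₂ (nth-mono rs bot-inS j≤l) (proj₂ (x∈p∩q⁻ (proj₁ (nth rs (toℕ l))) _ v∈l)))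
          }

        -- A graph with a vertex has a nonempty bag, so `k` exceeds 1. For `k = 1` no width could be
        -- less than `k ∸ 1`.
        1<k : 1 < k
        1<k with v ← fromℕ< 1≤n with i , v∈ , _ ← covers v v (inj₁ refl) =
          ≤-<-trans (subst (_≤ ∣ bags (toℕ i) ∣) (∣⁅x⁆∣≡1 v)
            (p⊆q⇒∣p∣≤∣q∣ (λ x∈ → subst (_∈ bags (toℕ i)) (sym (x∈⁅y⁆⇒x≡y v x∈)) v∈))) (small (toℕ i))

        0<k∸1 : 0 < k ∸ 1
        0<k∸1 = m<n⇒0<n∸m 1<k

      module _ (D : PathDecomposition G) (thin : width G D < k ∸ 1) where
        open PathDecomposition D

        thin-bag : ∀ i → ∣ W i ∣ < k
        thin-bag i = pred-<-pred⁻ 0<k (≤-<-trans (≤-bigMax _ i) thin)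

        before? : ∀ i v → Dec (∃ λ j → toℕ j < i × v ∈ W j)
        before? i v = Fin.any? λ j → (toℕ j <? i) ×-dec (v ∈? W j)

        after? : ∀ i v → Dec (∃ λ j → i ≤ toℕ j × v ∈ W j)
        after? i v = Fin.any? λ j → (i ≤? toℕ j) ×-dec (v ∈? W j)

        cut : ℕ → Sep G
        cut i = comprehension (before? i) , comprehension (after? i)

        cut-side : ∀ i v j → v ∈ W j → v ∈ proj₁ (cut i) ⊎ v ∈ proj₂ (cut i)
        cut-side i v j v∈ with toℕ j <? i
        ... | yes j<i = inj₁ (∈-comprehension⁺ (before? i) (j , j<i , v∈))
        ... | no j≮i  = inj₂ (∈-comprehension⁺ (after? i) (j , ≮⇒≥ j≮i , v∈))

        cut-mono : ∀ {i j} → i ≤ j → cut i ≼ cut j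
        cut-mono {i} {j} i≤j =
          (λ v∈ → let l , l<i , v∈l = ∈-comprehension⁻ (before? i) v∈
                  in ∈-comprehension⁺ (before? j) (l , <-≤-trans l<i i≤j , v∈l)) ,
          (λ v∈ → let l , j≤l , v∈l = ∈-comprehension⁻ (after? j) v∈
                  in ∈-comprehension⁺ (after? i) (l , ≤-trans i≤j j≤l , v∈l))

        -- A vertex in a bag up to `i` and in a bag from `i` on lies in bag `i` by interpolation;
        -- from index `r` on, the right side is empty.
        cut-bag : ∀ i → ∣ proj₂ (cut i) ∩ proj₁ (cut (suc i)) ∣ < k
        cut-bag i with i <? r
        ... | yes i<r = ≤-<-trans (p⊆q⇒∣p∣≤∣q∣ λ v∈ →
                let v∈₂ , v∈₁ = x∈p∩q⁻ (proj₂ (cut i)) _ v∈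
                    j , i≤j , v∈j = ∈-comprehension⁻ (after? i) v∈₂
                    l , l≤i , v∈l = ∈-comprehension⁻ (before? (suc i)) v∈₁
                    i≡ = Fin.toℕ-fromℕ< i<r
                in interp l (fromℕ< i<r) j (subst (toℕ l ≤_) (sym i≡) (≤-pred l≤i))
                     (subst (_≤ toℕ j) (sym i≡) i≤j) (x∈p∩q⁺ (v∈l , v∈j))) (thin-bag (fromℕ< i<r))
        ... | no i≮r = ≤-<-trans (p⊆q⇒∣p∣≤∣q∣ {q = ⊥} λ v∈ →
                let v∈₂ , _ = x∈p∩q⁻ (proj₂ (cut i)) _ v∈
                    j , i≤j , _ = ∈-comprehension⁻ (after? i) v∈₂
                in contradiction (≤-<-trans i≤j (Fin.toℕ<n j)) i≮r) (subst (_< k) (sym (∣⊥∣≡0 n)) 0<k)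

        -- The separator is part of the bag bounded by `cut-bag`. The ends of an edge share a bag,
        -- which lies on one side of the cut.
        cut-inS : ∀ i → InS G k (cut i)
        cut-inS i = (cover , noEdge) , ≤-<-trans (p⊆q⇒∣p∣≤∣q∣ λ v∈ →
            let v∈₁ , v∈₂ = x∈p∩q⁻ (proj₁ (cut i)) _ v∈
            in x∈p∩q⁺ (v∈₂ , proj₁ (cut-mono (n≤1+n i)) v∈₁)) (cut-bag i)
          where
          cover : ∀ v → v ∈ proj₁ (cut i) ⊎ v ∈ proj₂ (cut i)
          cover v = let j , v∈ = coversV v in cut-side i v j v∈
          noEdge : ∀ u v → Edge G u v → u ∈ proj₁ (cut i) → u ∉ proj₂ (cut i) →
            v ∈ proj₂ (cut i) → v ∉ proj₁ (cut i) → Absurd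
          noEdge u v e _ u∉ _ v∉ with j , u∈ , v∈ ← coversE u v e with cut-side i u j u∈ | toℕ j <? i
          ... | inj₂ u∈₂ | _       = u∉ u∈₂
          ... | inj₁ u∈₁ | yes j<i = v∉ (∈-comprehension⁺ (before? i) (j , j<i , v∈))
          ... | inj₁ u∈₁ | no j≮i  = u∉ (∈-comprehension⁺ (after? i) (j , ≮⇒≥ j≮i , u∈))

        cut-sweep : ∀ i → cut 0 ⟶* cut i
        cut-sweep zero    = ε
        cut-sweep (suc i) = cut-sweep i ◅◅
          ⟶*-bag (cut i) (cut (suc i)) (cut-mono (n≤1+n i)) (cut-inS i) (cut-inS (suc i)) (cut-bag i)

        pathDecomposition⇒sweep : bot ⟶* inv G bot
        pathDecomposition⇒sweep = subst₂ _⟶*_ first last (cut-sweep r)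
          where
          first : cut 0 ≡ bot
          first = ≼-antisym
            ((λ v∈ → let _ , j<0 , _ = ∈-comprehension⁻ (before? 0) v∈ in contradiction j<0 λ ()) ,
             (λ {v} _ → let j , v∈ = coversV v in ∈-comprehension⁺ (after? 0) (j , z≤n , v∈)))
            bot-min
          last : cut r ≡ inv G bot
          last = ≼-antisym (≼-inv bot-min)
            ((λ {v} _ → let j , v∈ = coversV v in ∈-comprehension⁺ (before? r) (j , Fin.toℕ<n j , v∈)) ,
             (λ v∈ → let j , r≤j , _ = ∈-comprehension⁻ (after? r) v∈
                     in contradiction (Fin.toℕ<n j) (≤⇒≯ r≤j)))

      -- The path labelled by a sweep

      module SweepTree (k≤n : k ≤ n) (rs : bot ⟶* inv G bot) where

        -- There is one edge for each of the `sweepLength rs + 1` separations of the sweep, the edge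
        -- from `i` to `i + 1` carrying the `i`-th; the number of nodes is one larger.
        open Tree (pathTree (suc (sweepLength rs)))

        at : ℕ → Sep G
        at = nth rs

        at-inS : ∀ i → InS G k (at i)
        at-inS i = proj₁ (nth-⟶ rs bot-inS i)

        α : Fin m → Fin m → Sep G
        α x y with toℕ x <? toℕ y
        ... | yes _ = at (toℕ x)
        ... | no _  = inv G (at (toℕ y))

        α-up : ∀ x y → suc (toℕ x) ≡ toℕ y → α x y ≡ at (toℕ x)
        α-up x y x<y with toℕ x <? toℕ y
        ... | yes _  = refl
        ... | no x≮y = contradiction (≤-reflexive x<y) x≮y

        α-down : ∀ x y → suc (toℕ y) ≡ toℕ x → α x y ≡ inv G (at (toℕ y))
        α-down x y y<x with toℕ x <? toℕ y
        ... | yes x<y = contradiction (<-trans x<y (≤-reflexive y<x)) (<-irrefl refl)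
        ... | no _    = refl

        α-inv : ∀ x y → adjT x y ≡ true → α y x ≡ inv G (α x y)
        α-inv x y e with does-true (consecutive? x y) e
        ... | inj₁ x<y = trans (α-down y x x<y) (cong (inv G) (sym (α-up x y x<y)))
        ... | inj₂ y<x = trans (α-up y x y<x) (cong (inv G) (sym (α-down x y y<x)))

        α-in : ∀ x y → adjT x y ≡ true → InS G k (α x y)
        α-in x y e with does-true (consecutive? x y) e
        ... | inj₁ x<y = subst (InS G k) (sym (α-up x y x<y)) (at-inS _)
        ... | inj₂ y<x = subst (InS G k) (sym (α-down x y y<x)) (inS-inv (at-inS _))

        Incoming : Fin m → Sep G → Set
        Incoming t s = ∃ λ x → adjT x t ≡ true × α x t ≡ s

        incoming-below : ∀ x t → suc (toℕ x) ≡ toℕ t → Incoming t (at (toℕ x))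
        incoming-below x t x<t = x , dec-true (consecutive? x t) (inj₁ x<t) , α-up x t x<t

        incoming-above : ∀ x t → suc (toℕ t) ≡ toℕ x → Incoming t (inv G (at (toℕ t)))
        incoming-above x t t<x = x , dec-true (consecutive? x t) (inj₂ t<x) , α-down x t t<x

        incoming-cases : ∀ t s → Incoming t s →
          (∃ λ i → suc i ≡ toℕ t × s ≡ at i) ⊎ (suc (toℕ t) < m × s ≡ inv G (at (toℕ t)))
        incoming-cases t s (x , e , refl) with does-true (consecutive? x t) e
        ... | inj₁ x<t = inj₁ (toℕ x , x<t , α-up x t x<t)
        ... | inj₂ t<x = inj₂ (subst (_< m) (sym t<x) (Fin.toℕ<n x) , α-down x t t<x)

        NodeStar : Fin m → Set
        NodeStar t = Σ (List (Sep G)) λ σ →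
          (∀ s → (s ∈ₗ σ → Incoming t s) × (Incoming t s → s ∈ₗ σ)) × InF2 G k σ

        nodeStar-single : ∀ t s → Incoming t s → (∀ u → Incoming t u → u ≡ s) →
          InS G k s → ∣ proj₂ s ∣ < k → NodeStar t
        nodeStar-single t s s∈ only S small =
          s ∷ [] , (λ u → (λ { (here refl) → s∈ }) , λ u∈ → here (only u u∈)) , F2-single k≤n s S small

        -- The two labels may coincide, and then the duplicate-free list has a single entry.
        nodeStar-pair : ∀ t s s′ → Incoming t s → Incoming t s′ → (∀ u → Incoming t u → u ≡ s ⊎ u ≡ s′) →
          InS G k s → InS G k s′ → s ≼ inv G s′ → ∣ proj₂ s ∩ proj₂ s′ ∣ < k → NodeStar t
        nodeStar-pair t s s′ s∈ s′∈ only S S′ s≼ small with s ≟ₛ s′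
        ... | yes refl = nodeStar-single t s s∈ (λ u u∈ → [ id , id ]′ (only u u∈)) S
                (subst (λ p → ∣ p ∣ < k) (∩-idem (proj₂ s)) small)
        ... | no s≢s′  = s ∷ s′ ∷ [] ,
                (λ u → (λ { (here refl) → s∈ ; (there (here refl)) → s′∈ }) ,
                  λ u∈ → [ here , (λ e → there (here e)) ]′ (only u u∈)) ,
                F2-pair k≤n s s′ s≢s′ S S′ s≼ small

        bot-small : ∣ proj₂ (inv G bot) ∣ < k
        bot-small = subst (_< k) (sym (∣⊥∣≡0 n)) 0<k

        -- As one side stays fixed, this intersection is the separator of `t` or of `s`.
        step-small : ∀ {s t} → s ⟶ t → ∣ proj₂ s ∩ proj₁ t ∣ < k
        step-small {s} {t} (_ , (_ , small) , inj₁ (_ , refl)) =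
          subst (λ p → ∣ p ∣ < k) (∩-comm (proj₁ t) (proj₂ t)) small
        step-small {s} {t} ((_ , small) , _ , inj₂ (refl , _)) =
          subst (λ p → ∣ p ∣ < k) (∩-comm (proj₁ s) (proj₂ s)) small

        α-star : ∀ t → NodeStar t
        -- At either end of the path the only incoming label is `inv G bot`, whose right-hand side
        -- is empty.
        α-star zero = nodeStar-single zero (inv G (at 0)) (incoming-above (suc zero) zero refl) only
          (inS-inv (at-inS 0)) (subst (λ s → ∣ proj₁ s ∣ < k) (sym (nth-first rs)) bot-small)
          where
          only : ∀ u → Incoming zero u → u ≡ inv G (at 0)
          only u u∈ with incoming-cases zero u u∈
          ... | inj₁ (_ , () , _)
          ... | inj₂ (_ , e) = e
        α-star (suc t) with suc (toℕ (suc t)) <? m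
        ... | yes t<m = nodeStar-pair (suc t) (at (toℕ t)) (inv G (at (suc (toℕ t))))
                (below t) (incoming-above (fromℕ< t<m) (suc t) (sym (Fin.toℕ-fromℕ< t<m))) only
                (at-inS _) (inS-inv (at-inS _)) (⟶⇒≼ next) (step-small next)
          where
          next = nth-⟶ rs bot-inS (toℕ t)
          below : ∀ t → Incoming (suc t) (at (toℕ t))
          below t = subst (λ i → Incoming (suc t) (at i)) (Fin.toℕ-inject₁ t)
            (incoming-below (inject₁ t) (suc t) (cong suc (Fin.toℕ-inject₁ t)))
          only : ∀ u → Incoming (suc t) u → u ≡ at (toℕ t) ⊎ u ≡ inv G (at (suc (toℕ t)))
          only u u∈ with incoming-cases (suc t) u u∈
          ... | inj₁ (_ , refl , e) = inj₁ e
          ... | inj₂ (_ , e)        = inj₂ e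
        ... | no t≮m = nodeStar-single (suc t) (at (toℕ t)) (below t) only (at-inS _)
                (subst (λ s → ∣ proj₂ s ∣ < k) (sym (trans (cong at last) (nth-last rs))) bot-small)
          where
          below : ∀ t → Incoming (suc t) (at (toℕ t))
          below t = subst (λ i → Incoming (suc t) (at i)) (Fin.toℕ-inject₁ t)
            (incoming-below (inject₁ t) (suc t) (cong suc (Fin.toℕ-inject₁ t)))
          last : toℕ t ≡ sweepLength rs
          -- The last of the `sweepLength rs + 2` nodes has index `sweepLength rs + 1`, which is
          -- `suc t`.
          last = ≤-antisym (≤-pred (Fin.toℕ<n t)) (≤-pred (≤-pred (≮⇒≥ t≮m)))
          only : ∀ u → Incoming (suc t) u → u ≡ at (toℕ t)
          only u u∈ with incoming-cases (suc t) u u∈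
          ... | inj₁ (_ , refl , e) = e
          ... | inj₂ (t<m , _)      = contradiction t<m t≮m

        skTree : SkTree G k
        skTree = record
          { T = pathTree (suc (sweepLength rs)) ; α = α ; α-in = α-in ; α-inv = α-inv ; α-star = α-star }

      sweep⇒skTree : bot ⟶* inv G bot → SkTree G k
      sweep⇒skTree rs with n <? k
      ... | yes n<k = singletonTree n<k
      ... | no n≮k  = SweepTree.skTree (≮⇒≥ n≮k) rs

theorem7p2 : (G : Graph) → 1 ≤ Graph.n G → (k : ℕ) → 0 < k →
    (HasBlockage G k ⇔ HasTangle G k) ×
    (HasTangle G k ⇔ (¬ SkTree G k)) ×
    ((¬ SkTree G k) ⇔ PathWidthAtLeast G (k ∸ 1))
theorem7p2 G 1≤n k 0<k =
  mk⇔ (blockage⇒tangle G k) (tangle⇒blockage G k) ,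
  mk⇔ (tangle⇒¬skTree G k)
    (λ ¬tree → unswept⇒tangle G k 0<k λ rs → ¬tree (sweep⇒skTree G k 0<k rs)) ,
  mk⇔
    (λ ¬tree D → ≮⇒≥ λ thin → ¬tree (sweep⇒skTree G k 0<k (pathDecomposition⇒sweep G k 0<k D thin)))
    -- An S_k-tree need not be a path, so it is not turned into a path-decomposition; large
    -- path-width yields a tangle, which excludes all S_k-trees.
    (λ wide → tangle⇒¬skTree G k (unswept⇒tangle G k 0<k λ rs →
      let D , thin = sweep⇒pathDecomposition G k 0<k 1≤n rs in <⇒≱ thin (wide D)))
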